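{- Let $q$ be a prime power, let $H$ be a normalized generalized Hadamard matrix $\mathrm{GH}(q,v/q)$ of order $v$ over the additive group of $\mathbb{F}_q$, let $K$ be a multiplicative group and $\phi:\mathbb{F}_q\to K$ an isomorphism from the additive group of $\mathbb{F}_q$ onto $K$. Let $Z=\{(kI,kI):k\in K\}\subseteq\mathrm{Aut}(\phi(H))$ and let $\Theta:\mathrm{Aut}(\phi(H))\to\mathrm{PAut}(\mathcal{E}_{\phi(H)})$ be the isomorphism described in the context. Then $C=C_H$ is a generalized Hadamard full propelinear code (GHFP-code) if and only if there is a subgroup $R\subseteq\mathrm{Aut}(\phi(H))$ with $Z\subseteq R$ such that $\Theta(R)$ is a regular subgroup of $\mathrm{PAut}(\mathcal{E}_{\phi(H)})$, with $\Theta(Z)\subseteq\Theta(R)$.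
   Context: Generalized Hadamard codes. A $v\times v$ matrix $H=(h_{ij})$ over the additive group $\mathbb{F}_q$, $q\mid v$, is a $\mathrm{GH}(q,v/q)$ if for all $i<j$ the multiset $\{h_{ik}-h_{jk}:1\le k\le v\}$ contains each element of $\mathbb{F}_q$ exactly $v/q$ times; it is normalized if its first row and column are zero. $F_H\subseteq\mathbb{F}_q^v$ is the set of rows of $H$ and $C_H=\bigcup_{\alpha\in\mathbb{F}_q}(F_H+\alpha\mathbf 1)$, with $\mathbf 1$ the all-one vector, is called a generalized Hadamard code. $\phi(H)=[\phi(h_{ij})]$. Full propelinear codes. For $\pi\in\mathcal{S}_n$ and $y\in\mathbb{F}_q^n$, $\pi(y)=(y_{\pi^{ -1}(1)},\dots,y_{\pi^{ -1}(n)})$. A code $C\subseteq\mathbb{F}_q^n$ with $\mathbf 0\in C$ is full propelinear if to every $x\in C$ can be assigned $\pi_x\in\mathcal{S}_n$ such that, writing $x\star y=x+\pi_x(y)$: (i) $x\star C=C$ for all $x\in C$; (ii) $\pi_{x\star y}=\pi_x\circ\pi_y$ for all $x,y\in C$; (iii) $\pi_x$ fixes no coordinate if $x\notin\{\alpha\mathbf 1:\alpha\in\mathbb{F}_q\}$, and $\pi_x=\mathrm{Id}$ if $x=\alpha\mathbf 1$ for some $\alpha\in\mathbb{F}_q$. A GHFP-code is a generalized Hadamard code that is full propelinear. Automorphisms. For a $v\times v$ matrix $M=(m_{ij})$ with entries in $K$, $\mathrm{Aut}(M)$ is the group of pairs $(P,Q)$ of monomial matrices with nonzero entries in $K$ such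 that $PMQ^*=M$ (computed over $\mathbb{Z}[K]$), where $Q^*$ is the transpose of $Q$ with each nonzero entry replaced by its inverse; multiplication is $(P,Q)(R,S)=(PR,QS)$. $\mathrm{PAut}(M)$ is the subgroup of pairs of permutation matrices. With $K=\{k_0=1,\dots,k_{q-1}\}$, $\mathcal{E}_M=[k_ik_jM]_{0\le i,j\le q-1}$; its rows and columns are indexed by $K\times\{1,\dots,v\}$, with entry $k\,l\,m_{ij}$ in position $((k,i),(l,j))$. The isomorphism $\Theta:\mathrm{Aut}(M)\to\mathrm{PAut}(\mathcal{E}_M)$ (for $M$ generalized Hadamard): if $P$ has nonzero entries $p_i$ in positions $(i,\alpha(i))$ and $Q$ has nonzero entries $q_j$ in positions $(j,\beta(j))$, then $\Theta(P,Q)=(P',Q')$ where $P'$ is the permutation matrix with ones in positions $((k,i),(kp_i,\alpha(i)))$ and $Q'$ the permutation matrix with ones in positions $((l,j),(lq_j^{ -1},\beta(j)))$, for $k,l\in K$. A subgroup of $\mathrm{PAut}(\mathcal{E}_M)$ is regular if its induced actions on the rows and on the columns of $\mathcal{E}_M$ are both regular. -}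

module Defs where

open import Algebra.Bundles using (Group; CommutativeMonoid; CommutativeRing)
import Algebra.Construct.DirectProduct as DirectProduct
open import Algebra.Definitions.RawMonoid using (sum)
import Algebra.Properties.CommutativeMonoid.Sum as Sum
import Algebra.Properties.Group as GroupProperties
open import Algebra.Morphism.Structures using (IsGroupIsomorphism)
open import Data.Fin.Base as Fin using (Fin; toℕ)
import Data.Fin.Properties as Fin
open import Data.Fin.Permutation using (Permutation′; _⟨$⟩ʳ_; _⟨$⟩ˡ_)
open import Data.Integer.Base as ℤ using (ℤ; 0ℤ; 1ℤ)
import Data.Integer.Properties as ℤ
open import Data.Nat.Base as ℕ using (ℕ; _^_; _≥_)
open import Data.Nat.Divisibility using (_∣_; quotient)
open import Data.Nat.Primality using (Prime)
open import Data.Product.Base using (∃; ∃-syntax; _×_; _,_; proj₁; proj₂)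
open import Data.Product.Function.NonDependent.Setoid using (_×-inverse_)
open import Data.Product.Relation.Binary.Pointwise.NonDependent
  using (×-setoid; Pointwise-≡↔≡)
open import Data.Sum.Base using (_⊎_)
import Data.Vec.Base as Vec
open import Function.Base using (_∘_)
open import Function.Bundles using (Func; Inverse; Bijection)
import Function.Construct.Composition as Composition
import Function.Construct.Identity as Identity
import Function.Construct.Symmetry as Symmetry
open import Function.Properties.Bijection using (Bijection⇒Inverse)
open import Function.Properties.Inverse using (Inverse⇒Injection)
open import Level using (Level; _⊔_)
open import Relation.Binary.Bundles using (Setoid)
open import Relation.Binary.Definitions using (Decidable)
open import Relation.Binary.PropositionalEquality as ≡ using (_≡_; _≢_)
open import Relation.Nullary using (¬_; Dec; yes; no; contradiction)
open import Relation.Nullary.Decidable using (via-injection)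
open import Relation.Unary using (Pred; _∈_; _≐_)

private
  variable
    a b c ℓ k κ i ι r s : Level

IsPrimePower : ℕ → Set
IsPrimePower q = ∃[ p ] ∃[ m ] (Prime p × m ≥ 1 × q ≡ p ^ m)

------------------------------------------------------------------------
-- Finite structures

record FiniteSetoid i ι : Set (Level.suc (i ⊔ ι)) where
  field
    setoid      : Setoid i ι
    size        : ℕ
    enumeration : Inverse (≡.setoid (Fin size)) setoid

  open Setoid setoid public

  elem : Fin size → Carrier
  elem = Inverse.to enumeration

  _≟_ : Decidable _≈_
  _≟_ = via-injection (Inverse⇒Injection (Symmetry.inverse enumeration)) Fin._≟_

finiteFin : ℕ → FiniteSetoid _ _
finiteFin n = record
  { setoid      = ≡.setoid (Fin n)
  ; size        = n
  ; enumeration = Identity.inverse _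
  }

infixr 2 _×ᶠ_
_×ᶠ_ : FiniteSetoid a b → FiniteSetoid i ι → FiniteSetoid (a ⊔ i) (b ⊔ ι)
A ×ᶠ B = record
  { setoid      = ×-setoid A.setoid B.setoid
  ; size        = A.size ℕ.* B.size
  ; enumeration = Composition.inverse Fin.*↔×
      (Composition.inverse (Symmetry.inverse Pointwise-≡↔≡)
                           (A.enumeration ×-inverse B.enumeration))
  }
  where module A = FiniteSetoid A
        module B = FiniteSetoid B

record FiniteGroup k κ : Set (Level.suc (k ⊔ κ)) where
  field
    group       : Group k κ
    order       : ℕ
    enumeration : Inverse (≡.setoid (Fin order)) (Group.setoid group)

  open Group group public

  finiteSetoid : FiniteSetoid k κ
  finiteSetoid = record { setoid = setoid ; size = order ; enumeration = enumeration }

  open FiniteSetoid finiteSetoid public using (elem; _≟_)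

record FiniteField c ℓ (q : ℕ) : Set (Level.suc (c ⊔ ℓ)) where
  field
    commutativeRing : CommutativeRing c ℓ

  open CommutativeRing commutativeRing public

  field
    0≉1         : ¬ (0# ≈ 1#)
    inverse     : ∀ x → ¬ (x ≈ 0#) → ∃[ y ] (x * y ≈ 1#)
    enumeration : Inverse (≡.setoid (Fin q)) setoid

  finiteSetoid : FiniteSetoid c ℓ
  finiteSetoid = record { setoid = setoid ; size = q ; enumeration = enumeration }

  open FiniteSetoid finiteSetoid public using (_≟_)

record IsSubgroup (G : Group c ℓ) (R : Pred (Group.Carrier G) r) : Set (c ⊔ ℓ ⊔ r) where
  open Group G
  field
    resp      : ∀ {x y} → x ≈ y → x ∈ R → y ∈ R
    ε-closed  : ε ∈ R
    ∙-closed  : ∀ {x y} → x ∈ R → y ∈ R → (x ∙ y) ∈ R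
    ⁻¹-closed : ∀ {x} → x ∈ R → (x ⁻¹) ∈ R

-- A sum with at most one nonzero term.
module _ (M : CommutativeMonoid c ℓ) where
  private
    module M = CommutativeMonoid M
    module ΣM = Sum M

  sum-zero : ∀ {n} (f : Fin n → M.Carrier) → (∀ t → f t M.≈ M.ε) → ΣM.sum f M.≈ M.ε
  sum-zero {n} f f≈ε = M.trans (ΣM.sum-cong-≋ f≈ε) (ΣM.sum-replicate-zero n)

  sum-single : ∀ {n} (f : Fin n → M.Carrier) t → (∀ u → u ≢ t → f u M.≈ M.ε) →
               ΣM.sum f M.≈ f t
  sum-single f Fin.zero f≈ε =
    M.trans (M.∙-congˡ (sum-zero (f ∘ Fin.suc) (λ u → f≈ε (Fin.suc u) λ ())))
            (M.identityʳ _)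
  sum-single f (Fin.suc t) f≈ε =
    M.trans (M.∙-cong (f≈ε Fin.zero λ ())
                      (sum-single (f ∘ Fin.suc) t
                        (λ u u≢t → f≈ε (Fin.suc u) (u≢t ∘ Fin.suc-injective))))
            (M.identityˡ _)

  sum-support : (I : FiniteSetoid i ι) → let open FiniteSetoid I in
                (f : Carrier → M.Carrier) →
                (∀ {x y} → x ≈ y → f x M.≈ f y) →
                ∀ x → (∀ y → ¬ (x ≈ y) → f y M.≈ M.ε) →
                ΣM.sum (f ∘ elem) M.≈ f x
  sum-support I f f-cong x f≈ε =
    M.trans (sum-single (f ∘ elem) (Inverse.from enumeration x)
              (λ u u≢ → f≈ε (elem u) (λ x≈ →
                u≢ (≡.sym (Inverse.inverseʳ enumeration x≈)))))
            (f-cong (Inverse.strictlyInverseˡ enumeration x))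
    where open FiniteSetoid I

------------------------------------------------------------------------
-- Generalized Hadamard codes and full propelinear codes

module Codes {q : ℕ} (𝔽 : FiniteField c ℓ q) where
  open FiniteField 𝔽

  Word : ℕ → Set c
  Word n = Fin n → Carrier

  Code : ℕ → Set (Level.suc (c ⊔ ℓ))
  Code n = Pred (Word n) (c ⊔ ℓ)

  infix 4 _≋_
  _≋_ : ∀ {n} → Word n → Word n → Set ℓ
  x ≋ y = ∀ i → x i ≈ y i

  infixl 6 _⊕_
  _⊕_ : ∀ {n} → Word n → Word n → Word n
  (x ⊕ y) i = x i + y i

  constant : ∀ {n} → Carrier → Word n
  constant α _ = α

  IsConstant : ∀ {n} → Word n → Set (c ⊔ ℓ)
  IsConstant x = ∃[ α ] (x ≋ constant α)

  permute : ∀ {n} → Permutation′ n → Word n → Word n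
  permute π y i = y (π ⟨$⟩ˡ i)

  SquareMatrix : ℕ → Set c
  SquareMatrix v = Fin v → Fin v → Carrier

  occurrences : ∀ {v} → Carrier → Word v → ℕ
  occurrences a x = Vec.count (_≟ a) (Vec.tabulate x)

  IsGH : ∀ {v} → q ∣ v → SquareMatrix v → Set c
  IsGH q∣v H = ∀ {i j} → i Fin.< j → ∀ a →
    occurrences a (λ k → H i k - H j k) ≡ quotient q∣v

  IsNormalized : ∀ {v} → SquareMatrix v → Set ℓ
  IsNormalized H = ∀ i j → toℕ i ≡ 0 ⊎ toℕ j ≡ 0 → H i j ≈ 0#

  C[_] : ∀ {v} → SquareMatrix v → Code v
  C[ H ] x = ∃[ i ] ∃[ α ] (x ≋ H i ⊕ constant α)

  IsGHCode : ∀ {v} → q ∣ v → Code v → Set (c ⊔ ℓ)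
  IsGHCode q∣v C = ∃[ H ] (IsGH q∣v H × C ≐ C[ H ])

  record FullPropelinear {n} (C : Code n) : Set (c ⊔ ℓ) where
    field
      0∈C    : constant 0# ∈ C
      π      : ∃ C → Permutation′ n
      -- π depends only on the codeword, not on the representative or on
      -- the proof of membership.
      π-cong : ∀ x y → proj₁ x ≋ proj₁ y → ∀ i → π x ⟨$⟩ʳ i ≡ π y ⟨$⟩ʳ i

    infixr 7 _⋆_
    _⋆_ : ∃ C → Word n → Word n
    x ⋆ y = proj₁ x ⊕ permute (π x) y

    field
      ⋆-closed   : ∀ x {y} → y ∈ C → (x ⋆ y) ∈ C
      ⋆-onto     : ∀ x {z} → z ∈ C → ∃[ y ] (y ∈ C × z ≋ x ⋆ y)
      π-homo     : ∀ x y z → proj₁ z ≋ x ⋆ proj₁ y →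
                   ∀ i → π z ⟨$⟩ʳ i ≡ π x ⟨$⟩ʳ (π y ⟨$⟩ʳ i)
      π-free     : ∀ x → ¬ IsConstant (proj₁ x) → ∀ i → π x ⟨$⟩ʳ i ≢ i
      π-constant : ∀ x → IsConstant (proj₁ x) → ∀ i → π x ⟨$⟩ʳ i ≡ i

  IsGHFP : ∀ {v} → q ∣ v → Code v → Set (c ⊔ ℓ)
  IsGHFP q∣v C = IsGHCode q∣v C × FullPropelinear C

------------------------------------------------------------------------
-- The integral group ring of a finite group

module GroupRing (K : FiniteGroup k κ) where
  open FiniteGroup K
  open ≡.≡-Reasoning

  private module Σℤ = Sum ℤ.+-0-commutativeMonoid

  -- An element Σ_g x(g) g is given by its coefficients x : K → ℤ.
  ℤ[K] : Set (k ⊔ κ)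
  ℤ[K] = Func setoid (≡.setoid ℤ)

  coeff : ℤ[K] → Carrier → ℤ
  coeff = Func.to

  infix 4 _≃_
  _≃_ : ℤ[K] → ℤ[K] → Set k
  x ≃ y = ∀ g → coeff x g ≡ coeff y g

  0ᴿ : ℤ[K]
  0ᴿ = record { to = λ _ → 0ℤ ; cong = λ _ → ≡.refl }

  infixl 6 _+ᴿ_
  _+ᴿ_ : ℤ[K] → ℤ[K] → ℤ[K]
  x +ᴿ y = record
    { to   = λ g → coeff x g ℤ.+ coeff y g
    ; cong = λ g≈h → ≡.cong₂ ℤ._+_ (Func.cong x g≈h) (Func.cong y g≈h)
    }

  infixl 7 _*ᴿ_
  _*ᴿ_ : ℤ[K] → ℤ[K] → ℤ[K]
  x *ᴿ y = record
    { to   = λ g → Σℤ.sum (λ t → coeff x (elem t) ℤ.* coeff y (elem t ⁻¹ ∙ g))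
    ; cong = λ g≈h → Σℤ.sum-cong-≋ λ t →
               ≡.cong (coeff x (elem t) ℤ.*_) (Func.cong y (∙-congˡ g≈h))
    }

  +ᴿ-commutativeMonoid : CommutativeMonoid (k ⊔ κ) k
  +ᴿ-commutativeMonoid = record
    { Carrier = ℤ[K] ; _≈_ = _≃_ ; _∙_ = _+ᴿ_ ; ε = 0ᴿ
    ; isCommutativeMonoid = record
      { isMonoid = record
        { isSemigroup = record
          { isMagma = record
            { isEquivalence = record
              { refl  = λ _ → ≡.refl
              ; sym   = λ p g → ≡.sym (p g)
              ; trans = λ p p′ g → ≡.trans (p g) (p′ g)
              }
            ; ∙-cong = λ p p′ g → ≡.cong₂ ℤ._+_ (p g) (p′ g)
            }
          ; assoc = λ x y z g → ℤ.+-assoc (coeff x g) (coeff y g) (coeff z g)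
          }
        ; identity = (λ x g → ℤ.+-identityˡ (coeff x g))
                   , (λ x g → ℤ.+-identityʳ (coeff x g))
        }
      ; comm = λ x y g → ℤ.+-comm (coeff x g) (coeff y g)
      }
    }

  open CommutativeMonoid +ᴿ-commutativeMonoid public using ()
    renaming (rawMonoid to +ᴿ-rawMonoid)

  δ : ∀ {p} {P : Set p} → Dec P → ℤ
  δ (yes _) = 1ℤ
  δ (no  _) = 0ℤ

  δ-yes : ∀ {p} {P : Set p} (d : Dec P) → P → δ d ≡ 1ℤ
  δ-yes (yes _) _ = ≡.refl
  δ-yes (no ¬p) p = contradiction p ¬p

  δ-no : ∀ {p} {P : Set p} (d : Dec P) → ¬ P → δ d ≡ 0ℤ
  δ-no (yes p) ¬p = contradiction p ¬p
  δ-no (no _)  _  = ≡.refl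

  δ-cong : ∀ {p p′} {P : Set p} {P′ : Set p′} (d : Dec P) (d′ : Dec P′) →
           (P → P′) → (P′ → P) → δ d ≡ δ d′
  δ-cong (yes _) (yes _) _ _ = ≡.refl
  δ-cong (yes p) (no ¬p) f _ = contradiction (f p) ¬p
  δ-cong (no ¬p) (yes p) _ f = contradiction (f p) ¬p
  δ-cong (no _)  (no _)  _ _ = ≡.refl

  ⟪_⟫ : Carrier → ℤ[K]
  ⟪ g ⟫ = record
    { to   = λ h → δ (g ≟ h)
    ; cong = λ {h} {h′} h≈h′ →
        δ-cong (g ≟ h) (g ≟ h′) (λ p → trans p h≈h′) (λ p → trans p (sym h≈h′))
    }

  *ᴿ-cong : ∀ {x x′ y y′} → x ≃ x′ → y ≃ y′ → x *ᴿ y ≃ x′ *ᴿ y′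
  *ᴿ-cong p p′ g = Σℤ.sum-cong-≋ λ t → ≡.cong₂ ℤ._*_ (p (elem t)) (p′ (elem t ⁻¹ ∙ g))

  *ᴿ-zeroˡ : ∀ x → 0ᴿ *ᴿ x ≃ 0ᴿ
  *ᴿ-zeroˡ x g = sum-zero ℤ.+-0-commutativeMonoid
    (λ t → 0ℤ ℤ.* coeff x (elem t ⁻¹ ∙ g)) (λ t → ℤ.*-zeroˡ (coeff x (elem t ⁻¹ ∙ g)))

  *ᴿ-zeroʳ : ∀ x → x *ᴿ 0ᴿ ≃ 0ᴿ
  *ᴿ-zeroʳ x g = sum-zero ℤ.+-0-commutativeMonoid
    (λ t → coeff x (elem t) ℤ.* 0ℤ) (λ t → ℤ.*-zeroʳ (coeff x (elem t)))

  ⟪⟫-cong : ∀ {g h} → g ≈ h → ⟪ g ⟫ ≃ ⟪ h ⟫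
  ⟪⟫-cong {g} {h} g≈h x = δ-cong (g ≟ x) (h ≟ x) (trans (sym g≈h)) (trans g≈h)

  ⟪⟫-homo : ∀ g h → ⟪ g ⟫ *ᴿ ⟪ h ⟫ ≃ ⟪ g ∙ h ⟫
  ⟪⟫-homo g h x = begin
    coeff (⟪ g ⟫ *ᴿ ⟪ h ⟫) x
      ≡⟨ sum-support ℤ.+-0-commutativeMonoid finiteSetoid term term-cong g term-zero ⟩
    δ (g ≟ g) ℤ.* δ (h ≟ (g ⁻¹ ∙ x))
      ≡⟨ ≡.cong (ℤ._* δ (h ≟ (g ⁻¹ ∙ x))) (δ-yes (g ≟ g) refl) ⟩
    1ℤ ℤ.* δ (h ≟ (g ⁻¹ ∙ x))
      ≡⟨ ℤ.*-identityˡ (δ (h ≟ (g ⁻¹ ∙ x))) ⟩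
    δ (h ≟ (g ⁻¹ ∙ x))
      ≡⟨ δ-cong (h ≟ (g ⁻¹ ∙ x)) ((g ∙ h) ≟ x)
           (λ p → trans (∙-congˡ p) (\\-leftDividesˡ g x))
           (λ p → trans (sym (\\-leftDividesʳ g h)) (∙-congˡ p)) ⟩
    coeff ⟪ g ∙ h ⟫ x ∎
    where
    open GroupProperties group
    term : Carrier → ℤ
    term y = coeff ⟪ g ⟫ y ℤ.* coeff ⟪ h ⟫ (y ⁻¹ ∙ x)
    term-cong : ∀ {y z} → y ≈ z → term y ≡ term z
    term-cong y≈z = ≡.cong₂ ℤ._*_ (Func.cong ⟪ g ⟫ y≈z)
                                   (Func.cong ⟪ h ⟫ (∙-congʳ (⁻¹-cong y≈z)))
    term-zero : ∀ y → ¬ (g ≈ y) → term y ≡ 0ℤ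
    term-zero y g≉y =
      ≡.trans (≡.cong (ℤ._* coeff ⟪ h ⟫ (y ⁻¹ ∙ x)) (δ-no (g ≟ y) g≉y))
              (ℤ.*-zeroˡ (coeff ⟪ h ⟫ (y ⁻¹ ∙ x)))

  when : ∀ {p} {P : Set p} → Dec P → Carrier → ℤ[K]
  when (yes _) g = ⟪ g ⟫
  when (no  _) g = 0ᴿ

  when-yes : ∀ {p} {P : Set p} (d : Dec P) {g} → P → when d g ≃ ⟪ g ⟫
  when-yes (yes _) _ _ = ≡.refl
  when-yes (no ¬p) p _ = contradiction p ¬p

  when-no : ∀ {p} {P : Set p} (d : Dec P) {g} → ¬ P → when d g ≃ 0ᴿ
  when-no (yes p) ¬p _ = contradiction p ¬p
  when-no (no _)  _  _ = ≡.refl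

  when-cong : ∀ {p p′} {P : Set p} {P′ : Set p′} (d : Dec P) (d′ : Dec P′) {g h} →
              (P → P′) → (P′ → P) → (P → g ≈ h) → when d g ≃ when d′ h
  when-cong (yes p) (yes _) _ _ g≈h = ⟪⟫-cong (g≈h p)
  when-cong (yes p) (no ¬p) f _ _   = contradiction (f p) ¬p
  when-cong (no ¬p) (yes p) _ f _   = contradiction (f p) ¬p
  when-cong (no _)  (no _)  _ _ _   = λ _ → ≡.refl

  when-*ᴿ : ∀ {p} {P : Set p} (d : Dec P) g h → ⟪ g ⟫ *ᴿ when d h ≃ when d (g ∙ h)
  when-*ᴿ (yes _) g h = ⟪⟫-homo g h
  when-*ᴿ (no _)  g h = *ᴿ-zeroʳ ⟪ g ⟫

------------------------------------------------------------------------
-- Monomial matrices with nonzero entries in K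

module Matrices (K : FiniteGroup k κ) (I : FiniteSetoid i ι) where
  private module K = FiniteGroup K
  open FiniteSetoid I
  open GroupRing K

  Matrix : Set (i ⊔ k ⊔ κ)
  Matrix = Carrier → Carrier → ℤ[K]

  infix 4 _≃ᴹ_
  _≃ᴹ_ : Matrix → Matrix → Set (i ⊔ k)
  A ≃ᴹ B = ∀ x y → A x y ≃ B x y

  infixl 7 _*ᴹ_
  _*ᴹ_ : Matrix → Matrix → Matrix
  (A *ᴹ B) x z = sum +ᴿ-rawMonoid (λ t → A x (elem t) *ᴿ B (elem t) z)

  -- The monomial matrix whose nonzero entries are `entry x` in position
  -- (x , perm x); its realisation over ℤ[K] is ⟦_⟧ below.
  record Monomial : Set (i ⊔ ι ⊔ k ⊔ κ) where
    field
      perm  : Inverse setoid setoid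
      entry : Func setoid K.setoid

    σ σ⁻ : Carrier → Carrier
    σ  = Inverse.to perm
    σ⁻ = Inverse.from perm

    e : Carrier → K.Carrier
    e = Func.to entry

  ⟦_⟧ : Monomial → Matrix
  ⟦ P ⟧ x y = when (σ x ≟ y) (e x)
    where open Monomial P

  -- The transpose of ⟦ P ⟧ with each nonzero entry inverted.
  ⟦_⟧* : Monomial → Matrix
  ⟦ P ⟧* x y = when (σ y ≟ x) (e y K.⁻¹)
    where open Monomial P

  -- The multiplication on this encoding is the matrix product
  -- over ℤ[K]: see ⟦⟧-homo.
  monomialGroup : Group (i ⊔ ι ⊔ k ⊔ κ) (i ⊔ ι ⊔ κ)
  monomialGroup = record
    { Carrier = Monomial
    ; _≈_     = λ P R → ∀ x → (σ P x ≈ σ R x) × (e P x K.≈ e R x)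
    ; _∙_     = _∙_
    ; ε       = ε
    ; _⁻¹     = _⁻¹
    ; isGroup = record
      { isMonoid = record
        { isSemigroup = record
          { isMagma = record
            { isEquivalence = record
              { refl  = λ _ → refl , K.refl
              ; sym   = λ p x → sym (proj₁ (p x)) , K.sym (proj₂ (p x))
              ; trans = λ p p′ x → trans (proj₁ (p x)) (proj₁ (p′ x))
                                 , K.trans (proj₂ (p x)) (proj₂ (p′ x))
              }
            ; ∙-cong = λ {P} {P′} {R} {R′} p r x →
                trans (σ-cong R (proj₁ (p x))) (proj₁ (r _)) ,
                K.∙-cong (proj₂ (p x))
                         (K.trans (e-cong R (proj₁ (p x))) (proj₂ (r _)))
            }
          ; assoc = λ _ _ _ _ → refl , K.assoc _ _ _
          }
        ; identity = (λ _ _ → refl , K.identityˡ _) , (λ _ _ → refl , K.identityʳ _)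
        }
      ; inverse =
          (λ P x → σσ⁻ P x , K.inverseˡ _) ,
          (λ P x → σ⁻σ P x ,
             K.trans (K.∙-congˡ (K.⁻¹-cong (e-cong P (σ⁻σ P x)))) (K.inverseʳ _))
      ; ⁻¹-cong = λ {P} {R} p x →
          let q : σ⁻ P x ≈ σ⁻ R x
              q = trans (sym (σ⁻σ R _))
                        (σ⁻-cong R (trans (sym (proj₁ (p _))) (σσ⁻ P x)))
          in q , K.⁻¹-cong (K.trans (proj₂ (p _)) (e-cong R q))
      }
    }
    where
    open Monomial
    σ-cong : ∀ P {x y} → x ≈ y → σ P x ≈ σ P y
    σ-cong P = Inverse.to-cong (perm P)
    σ⁻-cong : ∀ P {x y} → x ≈ y → σ⁻ P x ≈ σ⁻ P y
    σ⁻-cong P = Inverse.from-cong (perm P)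
    e-cong : ∀ P {x y} → x ≈ y → e P x K.≈ e P y
    e-cong P = Func.cong (entry P)
    σσ⁻ : ∀ P x → σ P (σ⁻ P x) ≈ x
    σσ⁻ P x = Inverse.strictlyInverseˡ (perm P) x
    σ⁻σ : ∀ P x → σ⁻ P (σ P x) ≈ x
    σ⁻σ P x = Inverse.strictlyInverseʳ (perm P) x
    _∙_ : Monomial → Monomial → Monomial
    P ∙ R = record
      { perm  = Composition.inverse (perm P) (perm R)
      ; entry = record
        { to   = λ x → e P x K.∙ e R (σ P x)
        ; cong = λ x≈y → K.∙-cong (e-cong P x≈y) (e-cong R (σ-cong P x≈y))
        }
      }
    ε : Monomial
    ε = record
      { perm  = Identity.inverse setoid
      ; entry = record { to = λ _ → K.ε ; cong = λ _ → K.refl }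
      }
    _⁻¹ : Monomial → Monomial
    P ⁻¹ = record
      { perm  = Symmetry.inverse (perm P)
      ; entry = record
        { to   = λ x → e P (σ⁻ P x) K.⁻¹
        ; cong = λ x≈y → K.⁻¹-cong (e-cong P (σ⁻-cong P x≈y))
        }
      }

  private
    module ≃ = CommutativeMonoid +ᴿ-commutativeMonoid

  -- ⟦ P ⟧ A has row σ(x) of A, multiplied by e(x), as its row x.
  ⟦⟧-*ᴹ : ∀ (P : Monomial) (A : Matrix) →
          (∀ {x y} z → x ≈ y → A x z ≃ A y z) →
          ∀ x z → (⟦ P ⟧ *ᴹ A) x z ≃ ⟪ Monomial.e P x ⟫ *ᴿ A (Monomial.σ P x) z
  ⟦⟧-*ᴹ P A A-cong x z =
    ≃.trans {(⟦ P ⟧ *ᴹ A) x z} {term (σ x)} {⟪ e x ⟫ *ᴿ A (σ x) z}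
      (sum-support +ᴿ-commutativeMonoid I term term-cong (σ x) term-zero)
      (*ᴿ-cong {⟦ P ⟧ x (σ x)} {⟪ e x ⟫} {A (σ x) z} {A (σ x) z}
        (when-yes (σ x ≟ σ x) refl) (λ _ → ≡.refl))
    where
    open Monomial P
    term : Carrier → ℤ[K]
    term y = ⟦ P ⟧ x y *ᴿ A y z
    term-cong : ∀ {y w} → y ≈ w → term y ≃ term w
    term-cong {y} {w} y≈w =
      *ᴿ-cong {⟦ P ⟧ x y} {⟦ P ⟧ x w} {A y z} {A w z}
        (when-cong (σ x ≟ y) (σ x ≟ w)
          (λ p → trans p y≈w) (λ p → trans p (sym y≈w)) (λ _ → K.refl))
        (A-cong z y≈w)
    term-zero : ∀ y → ¬ (σ x ≈ y) → term y ≃ 0ᴿ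
    term-zero y σx≉y =
      ≃.trans {term y} {0ᴿ *ᴿ A y z} {0ᴿ}
        (*ᴿ-cong {⟦ P ⟧ x y} {0ᴿ} {A y z} {A y z} (when-no (σ x ≟ y) σx≉y) (λ _ → ≡.refl))
        (*ᴿ-zeroˡ (A y z))

  ⟦⟧-homo : ∀ (P R : Monomial) →
            ⟦ Group._∙_ monomialGroup P R ⟧ ≃ᴹ ⟦ P ⟧ *ᴹ ⟦ R ⟧
  ⟦⟧-homo P R x z =
    ≃.sym {(⟦ P ⟧ *ᴹ ⟦ R ⟧) x z} {PR}
      (≃.trans {(⟦ P ⟧ *ᴹ ⟦ R ⟧) x z} {⟪ P.e x ⟫ *ᴿ ⟦ R ⟧ (P.σ x) z} {PR}
        (⟦⟧-*ᴹ P ⟦ R ⟧ ⟦R⟧-cong x z)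
        (when-*ᴿ (R.σ (P.σ x) ≟ z) (P.e x) (R.e (P.σ x))))
    where
    module P = Monomial P
    module R = Monomial R
    PR : ℤ[K]
    PR = ⟦ Group._∙_ monomialGroup P R ⟧ x z
    ⟦R⟧-cong : ∀ {y w} z → y ≈ w → ⟦ R ⟧ y z ≃ ⟦ R ⟧ w z
    ⟦R⟧-cong {y} {w} z y≈w = when-cong (R.σ y ≟ z) (R.σ w ≟ z)
      (trans (sym σy≈σw)) (trans σy≈σw) (λ _ → Func.cong R.entry y≈w)
      where σy≈σw = Inverse.to-cong R.perm y≈w

  pairGroup : Group (i ⊔ ι ⊔ k ⊔ κ) (i ⊔ ι ⊔ κ)
  pairGroup = DirectProduct.group monomialGroup monomialGroup

  MonomialPair : Set (i ⊔ ι ⊔ k ⊔ κ)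
  MonomialPair = Group.Carrier pairGroup

  open Group pairGroup public using () renaming (_≈_ to _≈ᴾ_; ε to εᴾ)

  KMatrix : Set (i ⊔ k)
  KMatrix = Carrier → Carrier → K.Carrier

  ⟨_⟩ : KMatrix → Matrix
  ⟨ M ⟩ x y = ⟪ M x y ⟫

  Aut : KMatrix → Pred MonomialPair (i ⊔ k)
  Aut M (P , Q) = ⟦ P ⟧ *ᴹ ⟨ M ⟩ *ᴹ ⟦ Q ⟧* ≃ᴹ ⟨ M ⟩

  IsPermutationMatrix : Pred Monomial (i ⊔ κ)
  IsPermutationMatrix P = ∀ x → Monomial.e P x K.≈ K.ε

  PAut : KMatrix → Pred MonomialPair (i ⊔ k ⊔ κ)
  PAut M (P , Q) =
    (P , Q) ∈ Aut M × IsPermutationMatrix P × IsPermutationMatrix Q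

  rowAction columnAction : MonomialPair → Carrier → Carrier
  rowAction    (P , Q) = Monomial.σ P
  columnAction (P , Q) = Monomial.σ Q

  RegularAction : Pred MonomialPair r → (MonomialPair → Carrier → Carrier) →
                  Set (i ⊔ ι ⊔ k ⊔ κ ⊔ r)
  RegularAction G act =
    (∀ x y → ∃[ g ] (g ∈ G × act g x ≈ y)) ×
    (∀ g → g ∈ G → ∀ x → act g x ≈ x → g ≈ᴾ εᴾ)

  IsRegular : Pred MonomialPair r → Set (i ⊔ ι ⊔ k ⊔ κ ⊔ r)
  IsRegular G = RegularAction G rowAction × RegularAction G columnAction

  scalar : K.Carrier → Monomial
  scalar g = record
    { perm  = Identity.inverse setoid
    ; entry = record { to = λ _ → g ; cong = λ _ → K.refl }
    }

  Z : Pred MonomialPair (i ⊔ ι ⊔ k ⊔ κ)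
  Z A = ∃[ g ] (A ≈ᴾ (scalar g , scalar g))

------------------------------------------------------------------------
-- The expanded matrix ℰ_M and the map Θ

infix 8 _×ᴷ_
_×ᴷ_ : FiniteGroup k κ → FiniteSetoid i ι → FiniteSetoid (k ⊔ i) (κ ⊔ ι)
K ×ᴷ I = FiniteGroup.finiteSetoid K ×ᶠ I

module Expansion (K : FiniteGroup k κ) (I : FiniteSetoid i ι) where
  private
    module K = FiniteGroup K
    module ℳ  = Matrices K I
    module ℳᴱ = Matrices K (K ×ᴷ I)
  open FiniteSetoid I

  ℰ : ℳ.KMatrix → ℳᴱ.KMatrix
  ℰ M (g , x) (h , y) = (g K.∙ h) K.∙ M x y

  -- The permutation matrix with ones in positions ((g , x) , (g p(x) , σ(x))).
  expand : Inverse setoid setoid → Func setoid K.setoid → ℳᴱ.Monomial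
  expand σ p = record
    { perm  = record
      { to        = to′
      ; from      = from′
      ; to-cong   = to′-cong
      ; from-cong = from′-cong
      ; inverse   =
          (λ {u} {w} w≈ → transS {to′ w} (to′-cong {w} w≈) (tofrom u)) ,
          (λ {u} {w} w≈ → transS {from′ w} (from′-cong {w} w≈) (fromto u))
      }
    ; entry = record { to = λ _ → K.ε ; cong = λ _ → K.refl }
    }
    where
    S = FiniteSetoid.setoid (K ×ᴷ I)
    open Setoid S using () renaming (Carrier to KI; _≈_ to _≈S_; trans to transS)
    open GroupProperties K.group
    to′ from′ : KI → KI
    to′   (g , x) = g K.∙ Func.to p x , Inverse.to σ x
    from′ (g , x) = g K.∙ Func.to p (Inverse.from σ x) K.⁻¹ , Inverse.from σ x
    to′-cong : ∀ {u w} → u ≈S w → to′ u ≈S to′ w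
    to′-cong (g≈h , x≈y) = K.∙-cong g≈h (Func.cong p x≈y) , Inverse.to-cong σ x≈y
    from′-cong : ∀ {u w} → u ≈S w → from′ u ≈S from′ w
    from′-cong (g≈h , x≈y) =
      K.∙-cong g≈h (K.⁻¹-cong (Func.cong p (Inverse.from-cong σ x≈y))) ,
      Inverse.from-cong σ x≈y
    tofrom : ∀ u → to′ (from′ u) ≈S u
    tofrom (g , x) = //-rightDividesˡ _ g , Inverse.strictlyInverseˡ σ x
    fromto : ∀ u → from′ (to′ u) ≈S u
    fromto (g , x) =
      K.trans (K.∙-congˡ (K.⁻¹-cong (Func.cong p (Inverse.strictlyInverseʳ σ x))))
              (//-rightDividesʳ _ g) ,
      Inverse.strictlyInverseʳ σ x

  -- Defined on all pairs of monomial matrices; only its restriction to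
  -- Aut(M), which takes values in PAut(ℰ_M), is of interest.
  Θ : ℳ.MonomialPair → ℳᴱ.MonomialPair
  Θ (P , Q) = expand P.perm P.entry , expand Q.perm Q.entry⁻¹
    where
    module P = ℳ.Monomial P
    module Q where
      open ℳ.Monomial Q public
      entry⁻¹ : Func setoid K.setoid
      entry⁻¹ = record
        { to   = λ x → e x K.⁻¹
        ; cong = λ x≈y → K.⁻¹-cong (Func.cong entry x≈y)
        }

  Θ[_] : Pred ℳ.MonomialPair r → Pred ℳᴱ.MonomialPair (i ⊔ ι ⊔ k ⊔ κ ⊔ r)
  Θ[ R ] B = ∃[ A ] (A ∈ R × B ℳᴱ.≈ᴾ Θ A)

------------------------------------------------------------------------
-- An isomorphic image of the additive group of a finite field

module _ {q : ℕ} (𝔽 : FiniteField c ℓ q) (K : Group k κ) where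
  private
    module 𝔽 = FiniteField 𝔽
    module K = Group K

  IsAdditiveIsomorphism : (𝔽.Carrier → K.Carrier) → Set (c ⊔ ℓ ⊔ k ⊔ κ)
  IsAdditiveIsomorphism = IsGroupIsomorphism (Group.rawGroup 𝔽.+-group) K.rawGroup

  imageGroup : (φ : 𝔽.Carrier → K.Carrier) → IsAdditiveIsomorphism φ → FiniteGroup k κ
  imageGroup φ iso = record
    { group       = K
    ; order       = q
    ; enumeration = Composition.inverse 𝔽.enumeration (Bijection⇒Inverse φ-bijection)
    }
    where
    open IsGroupIsomorphism iso
    φ-bijection : Bijection 𝔽.setoid K.setoid
    φ-bijection = record
      { to = φ ; cong = ⟦⟧-cong ; bijective = injective , surjective }

{-# OPTIONS --safe #-}
-- A pair (P , Q) with entries p, q and permutations σ, τ is an automorphism of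
-- N = φ(H) iff p(i) N(σ i, τ j) = N(i, j) q(j).  For a codeword x this says,
-- with τ = π_x and q(j) = φ(x(τ j)), that y ↦ x ⋆ y sends the row H i to
-- H (σ i) plus the constant φ⁻¹(p i).  Thus codewords x correspond to
-- automorphisms, with x read off from the image of row (1 , 0) of ℰ under Θ(P , Q)
-- since row 0 of H vanishes; the correspondence reverses products.
-- An element fixing a row or a column of ℰ has π_x with a fixed point, so x is
-- constant and then trivial; as there are as many codewords as rows (and columns)
-- of ℰ, freeness already gives transitivity.  Conversely, multiplying an element
-- of R whose τ has a fixed point by a suitable element of Z yields one fixing a
-- column of ℰ, so the element lies in Z and its codeword is constant.
module Submission where

open import Defs
open import Algebra.Bundles using (Group; CommutativeSemigroup)
open import Algebra.Definitions using (Commutative)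
import Algebra.Properties.CommutativeSemigroup as CommutativeSemigroupProperties
import Algebra.Properties.Group as GroupProperties
open import Algebra.Morphism.Structures using (IsGroupIsomorphism)
open import Data.Fin.Base as Fin using (Fin)
open import Data.Fin.Permutation using (Permutation′; _⟨$⟩ʳ_; _⟨$⟩ˡ_)
import Data.Fin.Properties as Fin
open import Data.Nat.Base as ℕ using (ℕ; NonZero)
import Data.Nat.Properties as ℕ
open import Data.Nat.Divisibility using (_∣_; quotient)
open import Data.Product.Base using (∃; ∃-syntax; _×_; _,_; proj₁; proj₂)
open import Data.Sum.Base using (inj₁)
import Data.Vec.Base as Vec
open import Function.Base using (_∘_)
open import Function.Bundles using (_⇔_; Func; Inverse; mk⇔)
open import Function.Definitions using (Injective)
open import Level using (Level; _⊔_)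
open import Relation.Binary.Definitions using (tri<; tri≈; tri>)
open import Relation.Binary.PropositionalEquality as ≡ using (_≡_; _≢_)
import Relation.Binary.Reasoning.Setoid as SetoidReasoning
open import Relation.Nullary using (¬_; yes; no; contradiction)
open import Relation.Unary using (Pred; _∈_; _⊆_; Decidable)

private
  variable
    c ℓ k κ i ι r : Level

-- Pigeonhole and counting on finite sets.

injective⇒surjective : ∀ {n} {f : Fin n → Fin n} → Injective _≡_ _≡_ f →
                       ∀ y → ∃[ x ] f x ≡ y
injective⇒surjective {n} {f} f-injective y with Fin.any? (λ x → f x Fin.≟ y)
... | yes y∈f = y∈f
... | no  y∉f = contradiction (Fin.injective⇒≤ g-injective) ℕ.1+n≰n
  where
  -- Prepending a missed value `y` to the values of `f` would inject `n + 1` points into `n`.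
  g : Fin (ℕ.suc n) → Fin n
  g Fin.zero    = y
  g (Fin.suc x) = f x
  g-injective : Injective _≡_ _≡_ g
  g-injective {Fin.zero}  {Fin.zero}  _  = ≡.refl
  g-injective {Fin.zero}  {Fin.suc w} eq = contradiction (w , ≡.sym eq) y∉f
  g-injective {Fin.suc x} {Fin.zero}  eq = contradiction (x , eq) y∉f
  g-injective {Fin.suc x} {Fin.suc w} eq = ≡.cong Fin.suc (f-injective eq)

count-tabulate-none : ∀ {a p n} {A : Set a} {P : Pred A p} (P? : Decidable P) (f : Fin n → A) →
                      (∀ j → ¬ P (f j)) → Vec.count P? (Vec.tabulate f) ≡ 0
count-tabulate-none {n = ℕ.zero}  P? f ¬P = ≡.refl
count-tabulate-none {n = ℕ.suc n} P? f ¬P with P? (f Fin.zero)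
... | yes P₀ = contradiction P₀ (¬P Fin.zero)
... | no  _  = count-tabulate-none P? (f ∘ Fin.suc) (¬P ∘ Fin.suc)

module _ (X : FiniteSetoid i ι) where
  open FiniteSetoid X

  injective⇒surjectiveˢ : {f : Carrier → Carrier} → Injective _≈_ _≈_ f →
                          ∀ y → ∃[ x ] f x ≈ y
  injective⇒surjectiveˢ {f} f-injective y = elem t , fx≈y
    where
    module enum = Inverse enumeration
    g : Fin size → Fin size
    g t = enum.from (f (elem t))
    from-injective : ∀ {x w} → enum.from x ≡ enum.from w → x ≈ w
    from-injective {x} {w} eq = trans (sym (enum.strictlyInverseˡ x))
      (trans (enum.to-cong eq) (enum.strictlyInverseˡ w))
    preimage : ∃[ t ] g t ≡ enum.from y
    preimage = injective⇒surjective
      (λ {t} {u} eq → ≡.trans (≡.sym (enum.strictlyInverseʳ t))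
        (≡.trans (enum.from-cong (f-injective (from-injective eq)))
                 (enum.strictlyInverseʳ u)))
      (enum.from y)
    t = proj₁ preimage
    fx≈y : f (elem t) ≈ y
    fx≈y = from-injective (proj₂ preimage)

-- Regularity of an action from freeness and counting.

module _ (K : FiniteGroup k κ) (X : FiniteSetoid i ι) where
  open Matrices K X
  open FiniteSetoid X
  private module 𝒢 = Group pairGroup

  -- Lets rows and columns share one regularity argument. The action is a right action, because the
  -- permutation of a product of monomials applies the left factor first.
  record IsAction (act : MonomialPair → Carrier → Carrier) : Set (i ⊔ ι ⊔ k ⊔ κ) where
    field
      act-cong : ∀ {g h x y} → g ≈ᴾ h → x ≈ y → act g x ≈ act h y
      act-ε    : ∀ x → act εᴾ x ≈ x
      act-∙    : ∀ g h x → act (g 𝒢.∙ h) x ≈ act h (act g x)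

  rowAction-isAction : IsAction rowAction
  rowAction-isAction = record
    { act-cong = λ {_} {h} g≈h x≈y →
        trans (proj₁ (proj₁ g≈h _)) (Inverse.to-cong (Monomial.perm (proj₁ h)) x≈y)
    ; act-ε    = λ _ → refl
    ; act-∙    = λ _ _ _ → refl
    }

  columnAction-isAction : IsAction columnAction
  columnAction-isAction = record
    { act-cong = λ {_} {h} g≈h x≈y →
        trans (proj₁ (proj₂ g≈h _)) (Inverse.to-cong (Monomial.perm (proj₂ h)) x≈y)
    ; act-ε    = λ _ → refl
    ; act-∙    = λ _ _ _ → refl
    }

  -- The family `f` supplies as many group elements as there are points. If `f u` and `f w` send `x`
  -- to the same point, then `f u ∙ f w ⁻¹` fixes `x` and is trivial by freeness. So the orbit map
  -- of `x` along `f` is injective, hence onto by finiteness.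
  free⇒regular : {G : Pred MonomialPair r} → IsSubgroup pairGroup G →
                 {act : MonomialPair → Carrier → Carrier} → IsAction act →
                 (f : Carrier → MonomialPair) → (∀ x → f x ∈ G) →
                 (∀ {x y} → f x ≈ᴾ f y → x ≈ y) →
                 (∀ g → g ∈ G → ∀ x → act g x ≈ x → g ≈ᴾ εᴾ) →
                 RegularAction G act
  free⇒regular {G = G} G≤ {act} isAction f f∈G f-injective free = transitive , free
    where
    open IsAction isAction
    open IsSubgroup G≤
    orbit-injective : ∀ x → Injective _≈_ _≈_ (λ u → act (f u) x)
    orbit-injective x {u} {w} eq = f-injective
      (GroupProperties.x∙y⁻¹≈ε⇒x≈y pairGroup (f u) (f w)
        (free (f u 𝒢.∙ f w 𝒢.⁻¹) (∙-closed (f∈G u) (⁻¹-closed (f∈G w))) x fixed))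
      where
      fixed : act (f u 𝒢.∙ f w 𝒢.⁻¹) x ≈ x
      fixed = begin
        act (f u 𝒢.∙ f w 𝒢.⁻¹) x         ≈⟨ act-∙ (f u) (f w 𝒢.⁻¹) x ⟩
        act (f w 𝒢.⁻¹) (act (f u) x)     ≈⟨ act-cong (𝒢.refl {f w 𝒢.⁻¹}) eq ⟩
        act (f w 𝒢.⁻¹) (act (f w) x)     ≈⟨ act-∙ (f w) (f w 𝒢.⁻¹) x ⟨
        act (f w 𝒢.∙ f w 𝒢.⁻¹) x         ≈⟨ act-cong (𝒢.inverseʳ (f w)) refl ⟩
        act εᴾ x                         ≈⟨ act-ε x ⟩
        x                                ∎
        where open SetoidReasoning setoid
    transitive : ∀ x y → ∃[ g ] (g ∈ G × act g x ≈ y)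
    transitive x y with u , eq ← injective⇒surjectiveˢ X (orbit-injective x) y =
      f u , f∈G u , eq

-- Automorphisms of a matrix over `K`, from group ring to entries.

module Automorphisms (K : FiniteGroup k κ) (I : FiniteSetoid i ι) where
  private module K = FiniteGroup K
  open FiniteSetoid I
  open GroupRing K
  open Matrices K I
  open Monomial
  private module 𝒢 = Group pairGroup

  ⟪⟫-injective : ∀ {g h} → ⟪ g ⟫ ≃ ⟪ h ⟫ → g K.≈ h
  ⟪⟫-injective {g} {h} eq with g K.≟ h | eq h
  ... | yes g≈h | _  = g≈h
  ... | no  _   | 0≡ with () ← ≡.trans 0≡ (δ-yes (h K.≟ h) K.refl)

  IsCongruent : KMatrix → Set (i ⊔ ι ⊔ κ)
  IsCongruent M = ∀ {x x′ y y′} → x ≈ x′ → y ≈ y′ → M x y K.≈ M x′ y′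

  module _ (M : KMatrix) (M-cong : IsCongruent M) where

    -- Column `z` of `⟦ Q ⟧*` is supported at `σ Q z` alone, and row `x` of `⟦ P ⟧` at `σ P x`
    -- alone, so each matrix product collapses to a single term.
    ⟦⟧*⟨⟩*⟦⟧*-entry : ∀ P Q x z → (⟦ P ⟧ *ᴹ ⟨ M ⟩ *ᴹ ⟦ Q ⟧*) x z ≃
      ⟪ (e P x K.∙ M (σ P x) (σ Q z)) K.∙ e Q z K.⁻¹ ⟫
    ⟦⟧*⟨⟩*⟦⟧*-entry P Q x z g = begin
      coeff ((⟦ P ⟧ *ᴹ ⟨ M ⟩ *ᴹ ⟦ Q ⟧*) x z) g
        ≡⟨ sum-support +ᴿ-commutativeMonoid I term term-cong (σ Q z) term-zero g ⟩
      coeff ((⟦ P ⟧ *ᴹ ⟨ M ⟩) x (σ Q z) *ᴿ ⟦ Q ⟧* (σ Q z) z) g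
        ≡⟨ *ᴿ-cong {(⟦ P ⟧ *ᴹ ⟨ M ⟩) x (σ Q z)} {⟪ e P x K.∙ M (σ P x) (σ Q z) ⟫}
                   {⟦ Q ⟧* (σ Q z) z} {⟪ e Q z K.⁻¹ ⟫}
                   (row (σ Q z)) (when-yes (σ Q z ≟ σ Q z) refl) g ⟩
      coeff (⟪ e P x K.∙ M (σ P x) (σ Q z) ⟫ *ᴿ ⟪ e Q z K.⁻¹ ⟫) g
        ≡⟨ ⟪⟫-homo (e P x K.∙ M (σ P x) (σ Q z)) (e Q z K.⁻¹) g ⟩
      coeff ⟪ (e P x K.∙ M (σ P x) (σ Q z)) K.∙ e Q z K.⁻¹ ⟫ g ∎
      where
      open ≡.≡-Reasoning
      row : ∀ y → (⟦ P ⟧ *ᴹ ⟨ M ⟩) x y ≃ ⟪ e P x K.∙ M (σ P x) y ⟫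
      row y h = ≡.trans
        (⟦⟧-*ᴹ P ⟨ M ⟩ (λ w x≈y → ⟪⟫-cong (M-cong x≈y refl)) x y h)
        (⟪⟫-homo (e P x) (M (σ P x) y) h)
      term : Carrier → ℤ[K]
      term y = (⟦ P ⟧ *ᴹ ⟨ M ⟩) x y *ᴿ ⟦ Q ⟧* y z
      term-cong : ∀ {y w} → y ≈ w → term y ≃ term w
      term-cong {y} {w} y≈w =
        *ᴿ-cong {(⟦ P ⟧ *ᴹ ⟨ M ⟩) x y} {(⟦ P ⟧ *ᴹ ⟨ M ⟩) x w} {⟦ Q ⟧* y z} {⟦ Q ⟧* w z}
          (λ h → ≡.trans (row y h)
            (≡.trans (⟪⟫-cong (K.∙-congˡ (M-cong refl y≈w)) h) (≡.sym (row w h))))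
          (when-cong (σ Q z ≟ y) (σ Q z ≟ w)
            (λ p → trans p y≈w) (λ p → trans p (sym y≈w)) (λ _ → K.refl))
      term-zero : ∀ y → ¬ (σ Q z ≈ y) → term y ≃ 0ᴿ
      term-zero y σz≉y h = ≡.trans
        (*ᴿ-cong {(⟦ P ⟧ *ᴹ ⟨ M ⟩) x y} {(⟦ P ⟧ *ᴹ ⟨ M ⟩) x y} {⟦ Q ⟧* y z} {0ᴿ}
          (λ _ → ≡.refl) (when-no (σ Q z ≟ y) σz≉y) h)
        (*ᴿ-zeroʳ ((⟦ P ⟧ *ᴹ ⟨ M ⟩) x y) h)

    -- The automorphism condition as an equation inside `K`, with the entry of `Q` moved to the
    -- right; it can be composed and inverted without sums over the group ring.
    Preserves : MonomialPair → Set (i ⊔ κ)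
    Preserves (P , Q) = ∀ x z → e P x K.∙ M (σ P x) (σ Q z) K.≈ M x z K.∙ e Q z

    Aut⇒Preserves : ∀ {A} → A ∈ Aut M → Preserves A
    Aut⇒Preserves {P , Q} A∈Aut x z = K.trans
      (K.sym (//-rightDividesˡ (e Q z) _))
      (K.∙-congʳ (⟪⟫-injective λ g →
        ≡.trans (≡.sym (⟦⟧*⟨⟩*⟦⟧*-entry P Q x z g)) (A∈Aut x z g)))
      where open GroupProperties K.group

    Preserves⇒Aut : ∀ {A} → Preserves A → A ∈ Aut M
    Preserves⇒Aut {P , Q} A-pres x z g = ≡.trans
      (⟦⟧*⟨⟩*⟦⟧*-entry P Q x z g)
      (⟪⟫-cong (K.trans (K.∙-congʳ (A-pres x z)) (//-rightDividesʳ (e Q z) _)) g)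
      where open GroupProperties K.group

    Preserves-resp : ∀ {A B} → A ≈ᴾ B → Preserves A → Preserves B
    Preserves-resp {P , Q} {P′ , Q′} (P≈ , Q≈) A-pres x z = begin
      e P′ x K.∙ M (σ P′ x) (σ Q′ z)
        ≈⟨ K.∙-cong (proj₂ (P≈ x)) (M-cong (proj₁ (P≈ x)) (proj₁ (Q≈ z))) ⟨
      e P x K.∙ M (σ P x) (σ Q z)     ≈⟨ A-pres x z ⟩
      M x z K.∙ e Q z                 ≈⟨ K.∙-congˡ (proj₂ (Q≈ z)) ⟩
      M x z K.∙ e Q′ z                ∎
      where open SetoidReasoning K.setoid

    Preserves-∙ : ∀ {A B} → Preserves A → Preserves B → Preserves (A 𝒢.∙ B)
    Preserves-∙ {P , Q} {P′ , Q′} A-pres B-pres x z = begin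
      (e P x K.∙ e P′ (σ P x)) K.∙ M (σ P′ (σ P x)) (σ Q′ (σ Q z))
        ≈⟨ K.assoc _ _ _ ⟩
      e P x K.∙ (e P′ (σ P x) K.∙ M (σ P′ (σ P x)) (σ Q′ (σ Q z)))
        ≈⟨ K.∙-congˡ (B-pres (σ P x) (σ Q z)) ⟩
      e P x K.∙ (M (σ P x) (σ Q z) K.∙ e Q′ (σ Q z))
        ≈⟨ K.assoc _ _ _ ⟨
      (e P x K.∙ M (σ P x) (σ Q z)) K.∙ e Q′ (σ Q z)
        ≈⟨ K.∙-congʳ (A-pres x z) ⟩
      (M x z K.∙ e Q z) K.∙ e Q′ (σ Q z)
        ≈⟨ K.assoc _ _ _ ⟩
      M x z K.∙ (e Q z K.∙ e Q′ (σ Q z)) ∎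
      where open SetoidReasoning K.setoid

    Preserves-ε : Preserves εᴾ
    Preserves-ε x z = K.trans (K.identityˡ _) (K.sym (K.identityʳ _))

    Preserves-⁻¹ : ∀ {A} → Preserves A → Preserves (A 𝒢.⁻¹)
    Preserves-⁻¹ {P , Q} A-pres x z = begin
      e P x′ K.⁻¹ K.∙ M x′ z′
        ≈⟨ K.∙-congˡ (//-rightDividesʳ (e Q z′) (M x′ z′)) ⟨
      e P x′ K.⁻¹ K.∙ ((M x′ z′ K.∙ e Q z′) K.∙ e Q z′ K.⁻¹)
        ≈⟨ K.∙-congˡ (K.∙-congʳ (A-pres x′ z′)) ⟨
      e P x′ K.⁻¹ K.∙ ((e P x′ K.∙ M (σ P x′) (σ Q z′)) K.∙ e Q z′ K.⁻¹)
        ≈⟨ K.assoc _ _ _ ⟨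
      (e P x′ K.⁻¹ K.∙ (e P x′ K.∙ M (σ P x′) (σ Q z′))) K.∙ e Q z′ K.⁻¹
        ≈⟨ K.∙-congʳ (\\-leftDividesʳ (e P x′) _) ⟩
      M (σ P x′) (σ Q z′) K.∙ e Q z′ K.⁻¹
        ≈⟨ K.∙-congʳ (M-cong (Inverse.strictlyInverseˡ (perm P) x)
                             (Inverse.strictlyInverseˡ (perm Q) z)) ⟩
      M x z K.∙ e Q z′ K.⁻¹ ∎
      where
      open SetoidReasoning K.setoid
      open GroupProperties K.group
      x′ = σ⁻ P x
      z′ = σ⁻ Q z

-- `Θ` as an injective homomorphism into the permutation automorphisms of `ℰ`.

module ExpansionProperties (K : FiniteGroup k κ) (I : FiniteSetoid i ι)
  (comm : Commutative (FiniteGroup._≈_ K) (FiniteGroup._∙_ K)) where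
  private
    module K = FiniteGroup K
    module M = Matrices K I
    module E = Matrices K (K ×ᴷ I)
    module 𝒢 = Group M.pairGroup
    module 𝒢ᴱ = Group E.pairGroup
  open FiniteSetoid I
  open Expansion K I
  open M.Monomial
  open GroupProperties K.group

  K-commutativeSemigroup : CommutativeSemigroup k κ
  K-commutativeSemigroup = record
    { isCommutativeSemigroup = record { isSemigroup = K.isSemigroup ; comm = comm } }
  open CommutativeSemigroupProperties K-commutativeSemigroup

  Θ-cong : ∀ {A B} → A M.≈ᴾ B → Θ A E.≈ᴾ Θ B
  Θ-cong (P≈ , Q≈) =
    (λ (g , x) → (K.∙-congˡ (proj₂ (P≈ x)) , proj₁ (P≈ x)) , K.refl) ,
    (λ (g , x) → (K.∙-congˡ (K.⁻¹-cong (proj₂ (Q≈ x))) , proj₁ (Q≈ x)) , K.refl)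

  -- The images of the points `(ε , x)` already show both the permutation and the entries.
  Θ-injective : ∀ {A B} → Θ A E.≈ᴾ Θ B → A M.≈ᴾ B
  Θ-injective (P≈ , Q≈) =
    (λ x → proj₂ (proj₁ (P≈ (K.ε , x))) ,
           ∙-cancelˡ′ (proj₁ (proj₁ (P≈ (K.ε , x))))) ,
    (λ x → proj₂ (proj₁ (Q≈ (K.ε , x))) ,
           ⁻¹-injective (∙-cancelˡ′ (proj₁ (proj₁ (Q≈ (K.ε , x))))))
    where
    ∙-cancelˡ′ : ∀ {g h} → K.ε K.∙ g K.≈ K.ε K.∙ h → g K.≈ h
    ∙-cancelˡ′ eq = K.trans (K.sym (K.identityˡ _)) (K.trans eq (K.identityˡ _))

  -- `Θ` inverts the entries of `Q`, so on columns commutativity of `K` is what keeps the order of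
  -- the factors.
  Θ-∙ : ∀ A B → Θ (A 𝒢.∙ B) E.≈ᴾ Θ A 𝒢ᴱ.∙ Θ B
  Θ-∙ (P , Q) (P′ , Q′) =
    (λ (g , x) → (K.sym (K.assoc _ _ _) , refl) , K.sym (K.identityʳ _)) ,
    (λ (g , x) → (K.trans (K.∙-congˡ (⁻¹-homo (e Q x) (e Q′ (σ Q x)))) (K.sym (K.assoc _ _ _))
                 , refl) , K.sym (K.identityʳ _))
    where
    ⁻¹-homo : ∀ g h → (g K.∙ h) K.⁻¹ K.≈ g K.⁻¹ K.∙ h K.⁻¹
    ⁻¹-homo g h = K.trans (⁻¹-anti-homo-∙ g h) (comm _ _)

  Θ-ε : Θ M.εᴾ E.≈ᴾ E.εᴾ
  Θ-ε = (λ _ → (K.identityʳ _ , refl) , K.refl) ,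
        (λ _ → (K.trans (K.∙-congˡ ε⁻¹≈ε) (K.identityʳ _) , refl) , K.refl)

  Θ-⁻¹ : ∀ A → Θ (A 𝒢.⁻¹) E.≈ᴾ Θ A 𝒢ᴱ.⁻¹
  Θ-⁻¹ A = GroupProperties.inverseˡ-unique E.pairGroup (Θ (A 𝒢.⁻¹)) (Θ A)
    (𝒢ᴱ.trans {Θ (A 𝒢.⁻¹) 𝒢ᴱ.∙ Θ A} {Θ (A 𝒢.⁻¹ 𝒢.∙ A)} {E.εᴾ}
      (𝒢ᴱ.sym {Θ (A 𝒢.⁻¹ 𝒢.∙ A)} {Θ (A 𝒢.⁻¹) 𝒢ᴱ.∙ Θ A} (Θ-∙ (A 𝒢.⁻¹) A))
      (𝒢ᴱ.trans {Θ (A 𝒢.⁻¹ 𝒢.∙ A)} {Θ M.εᴾ} {E.εᴾ}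
        (Θ-cong {A 𝒢.⁻¹ 𝒢.∙ A} {M.εᴾ} (𝒢.inverseˡ A)) Θ-ε))

  Θ-isSubgroup : {R : Pred M.MonomialPair r} →
                 IsSubgroup M.pairGroup R → IsSubgroup E.pairGroup Θ[ R ]
  Θ-isSubgroup {R = R} R≤ = record
    { resp      = λ { {B} {B′} B≈B′ (A , A∈R , B≈) →
        A , A∈R , 𝒢ᴱ.trans {B′} {B} {Θ A} (𝒢ᴱ.sym {B} {B′} B≈B′) B≈ }
    ; ε-closed  = M.εᴾ , ε-closed , 𝒢ᴱ.sym {Θ M.εᴾ} {E.εᴾ} Θ-ε
    ; ∙-closed  = λ { {B} {B′} (A , A∈R , B≈) (A′ , A′∈R , B′≈) →
        A 𝒢.∙ A′ , ∙-closed A∈R A′∈R ,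
        𝒢ᴱ.trans {B 𝒢ᴱ.∙ B′} {Θ A 𝒢ᴱ.∙ Θ A′} {Θ (A 𝒢.∙ A′)}
          (𝒢ᴱ.∙-cong {B} {Θ A} {B′} {Θ A′} B≈ B′≈)
          (𝒢ᴱ.sym {Θ (A 𝒢.∙ A′)} {Θ A 𝒢ᴱ.∙ Θ A′} (Θ-∙ A A′)) }
    ; ⁻¹-closed = λ { {B} (A , A∈R , B≈) → A 𝒢.⁻¹ , ⁻¹-closed A∈R ,
        𝒢ᴱ.trans {B 𝒢ᴱ.⁻¹} {Θ A 𝒢ᴱ.⁻¹} {Θ (A 𝒢.⁻¹)}
          (𝒢ᴱ.⁻¹-cong {B} {Θ A} B≈) (𝒢ᴱ.sym {Θ (A 𝒢.⁻¹)} {Θ A 𝒢ᴱ.⁻¹} (Θ-⁻¹ A)) }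
    }
    where open IsSubgroup R≤

  module _ (M : M.KMatrix) (M-cong : Automorphisms.IsCongruent K I M) where

    ℰ-cong : Automorphisms.IsCongruent K (K ×ᴷ I) (ℰ M)
    ℰ-cong (g≈ , x≈) (h≈ , y≈) = K.∙-cong (K.∙-cong g≈ h≈) (M-cong x≈ y≈)

    -- The factors `e P x` and `e Q z ⁻¹` that `Θ` adds to the two `K`-coordinates meet in one entry
    -- of `ℰ M`, where the automorphism equation cancels them.
    Θ-Aut⊆PAut : {R : Pred M.MonomialPair r} → R ⊆ M.Aut M → Θ[ R ] ⊆ E.PAut (ℰ M)
    Θ-Aut⊆PAut R⊆Aut {B} (A@(P , Q) , A∈R , B≈) =
      ME.Preserves⇒Aut (ℰ M) ℰ-cong {B}
        (ME.Preserves-resp (ℰ M) ℰ-cong {Θ A} {B} (𝒢ᴱ.sym {B} {Θ A} B≈) Θ-preserves) ,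
      (λ u → proj₂ (proj₁ B≈ u)) , (λ u → proj₂ (proj₂ B≈ u))
      where
      module ME = Automorphisms K (K ×ᴷ I)
      module MA = Automorphisms K I
      open SetoidReasoning K.setoid
      Θ-preserves : ME.Preserves (ℰ M) ℰ-cong (Θ A)
      Θ-preserves (g , x) (h , z) = K.trans (K.identityˡ _) (K.trans (begin
        ((g K.∙ e P x) K.∙ (h K.∙ e Q z K.⁻¹)) K.∙ M (σ P x) (σ Q z)
          ≈⟨ K.∙-congʳ (interchange g (e P x) h (e Q z K.⁻¹)) ⟩
        ((g K.∙ h) K.∙ (e P x K.∙ e Q z K.⁻¹)) K.∙ M (σ P x) (σ Q z)
          ≈⟨ K.assoc _ _ _ ⟩
        (g K.∙ h) K.∙ ((e P x K.∙ e Q z K.⁻¹) K.∙ M (σ P x) (σ Q z))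
          ≈⟨ K.∙-congˡ (xy∙z≈xz∙y (e P x) (e Q z K.⁻¹) _) ⟩
        (g K.∙ h) K.∙ ((e P x K.∙ M (σ P x) (σ Q z)) K.∙ e Q z K.⁻¹)
          ≈⟨ K.∙-congˡ (K.∙-congʳ (MA.Aut⇒Preserves M M-cong {A} (R⊆Aut A∈R) x z)) ⟩
        (g K.∙ h) K.∙ ((M x z K.∙ e Q z) K.∙ e Q z K.⁻¹)
          ≈⟨ K.∙-congˡ (//-rightDividesʳ (e Q z) (M x z)) ⟩
        (g K.∙ h) K.∙ M x z ∎) (K.sym (K.identityʳ _)))

-- Codewords as translates of rows, written multiplicatively in `K`.

module HadamardCode {q : ℕ} (𝔽 : FiniteField c ℓ q) {n : ℕ} (q∣v : q ∣ ℕ.suc n)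
  (H : Codes.SquareMatrix 𝔽 (ℕ.suc n)) (isGH : Codes.IsGH 𝔽 q∣v H)
  (isNormalized : Codes.IsNormalized 𝔽 H)
  (K₀ : Group k κ) (φ : FiniteField.Carrier 𝔽 → Group.Carrier K₀)
  (φ-iso : IsAdditiveIsomorphism 𝔽 K₀ φ) where

  v : ℕ
  v = ℕ.suc n

  Kᶠ : FiniteGroup k κ
  Kᶠ = imageGroup 𝔽 K₀ φ φ-iso

  I : FiniteSetoid _ _
  I = finiteFin v

  open Codes 𝔽
  open Expansion Kᶠ I
  private
    module F = FiniteField 𝔽
    module K = FiniteGroup Kᶠ
    module M = Matrices Kᶠ I
    module E = Matrices Kᶠ (Kᶠ ×ᴷ I)
    module 𝒢 = Group M.pairGroup
  open M.Monomial
  open IsGroupIsomorphism φ-iso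
    using ()
    renaming (⟦⟧-cong to φ-cong; ∙-homo to φ-+; ε-homo to φ-0; ⁻¹-homo to φ-neg;
              injective to φ-injective; surjective to φ-surjective)
  open GroupProperties K.group
  open SetoidReasoning K.setoid

  φ⁻¹ : K.Carrier → F.Carrier
  φ⁻¹ g = proj₁ (φ-surjective g)

  φ∘φ⁻¹ : ∀ g → φ (φ⁻¹ g) K.≈ g
  φ∘φ⁻¹ g = proj₂ (φ-surjective g) F.refl

  K-comm : Commutative K._≈_ K._∙_
  K-comm g h = begin
    g K.∙ h                      ≈⟨ K.∙-cong (φ∘φ⁻¹ g) (φ∘φ⁻¹ h) ⟨
    φ (φ⁻¹ g) K.∙ φ (φ⁻¹ h)      ≈⟨ φ-+ (φ⁻¹ g) (φ⁻¹ h) ⟨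
    φ (φ⁻¹ g F.+ φ⁻¹ h)          ≈⟨ φ-cong (F.+-comm (φ⁻¹ g) (φ⁻¹ h)) ⟩
    φ (φ⁻¹ h F.+ φ⁻¹ g)          ≈⟨ φ-+ (φ⁻¹ h) (φ⁻¹ g) ⟩
    φ (φ⁻¹ h) K.∙ φ (φ⁻¹ g)      ≈⟨ K.∙-cong (φ∘φ⁻¹ h) (φ∘φ⁻¹ g) ⟩
    h K.∙ g                      ∎

  open ExpansionProperties Kᶠ I K-comm
  open CommutativeSemigroupProperties K-commutativeSemigroup

  N : M.KMatrix
  N i j = φ (H i j)

  N-cong : Automorphisms.IsCongruent Kᶠ I N
  N-cong ≡.refl ≡.refl = K.refl

  N-row₀ : ∀ j → N Fin.zero j K.≈ K.ε
  N-row₀ j = K.trans (φ-cong (isNormalized Fin.zero j (inj₁ ≡.refl))) φ-0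

  open Automorphisms Kᶠ I using (Aut⇒Preserves; Preserves⇒Aut; Preserves-resp;
                                 Preserves-∙; Preserves-ε; Preserves-⁻¹)

  Preserves : M.MonomialPair → Set κ
  Preserves = Automorphisms.Preserves Kᶠ I N N-cong

  -- A constant difference α would make α + 1 occur zero times, not v/q times.
  difference-not-constant : ∀ {i j} → i Fin.< j → ∀ α → ¬ (∀ t → H i t F.- H j t F.≈ α)
  difference-not-constant {i} {j} i<j α const =
    contradiction (≡.trans (_∣_.equality q∣v) (≡.cong (ℕ._* q) quotient≡0)) λ ()
    where
    +1-fixed : ¬ (α F.≈ α F.+ F.1#)
    +1-fixed eq = F.0≉1 (F.sym (GroupProperties.identityʳ-unique F.+-group α F.1# (F.sym eq)))
    quotient≡0 : quotient q∣v ≡ 0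
    quotient≡0 = ≡.trans (≡.sym (isGH i<j (α F.+ F.1#)))
      (count-tabulate-none (F._≟ (α F.+ F.1#)) (λ t → H i t F.- H j t)
        (λ t eq → +1-fixed (F.trans (F.sym (const t)) eq)))

  -- Agreeing translates of two different rows would make their difference constantly
  -- `φ⁻¹ (h ∙ g ⁻¹)`; for equal rows, column 0 cancels. Hence a codeword determines its row and its
  -- constant, and codewords match the row indices of `ℰ`.
  rows-unique : ∀ {i j g h} → (∀ t → N i t K.∙ g K.≈ N j t K.∙ h) → i ≡ j × g K.≈ h
  rows-unique {i} {j} {g} {h} eq = i≡j , g≈h i≡j eq
    where
    unequal : ∀ {i j g h} → i Fin.< j → ¬ (∀ t → N i t K.∙ g K.≈ N j t K.∙ h)
    unequal {i} {j} {g} {h} i<j eq =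
      difference-not-constant i<j (φ⁻¹ (h K.∙ g K.⁻¹)) λ t → φ-injective (begin
        φ (H i t F.- H j t)
          ≈⟨ φ-+ (H i t) (F.- H j t) ⟩
        N i t K.∙ φ (F.- H j t)
          ≈⟨ K.∙-congˡ (φ-neg (H j t)) ⟩
        N i t K.∙ N j t K.⁻¹
          ≈⟨ K.∙-congʳ (//-rightDividesʳ g (N i t)) ⟨
        ((N i t K.∙ g) K.∙ g K.⁻¹) K.∙ N j t K.⁻¹
          ≈⟨ K.∙-congʳ (K.∙-congʳ (eq t)) ⟩
        ((N j t K.∙ h) K.∙ g K.⁻¹) K.∙ N j t K.⁻¹
          ≈⟨ K.∙-congʳ (K.assoc (N j t) h (g K.⁻¹)) ⟩
        (N j t K.∙ (h K.∙ g K.⁻¹)) K.∙ N j t K.⁻¹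
          ≈⟨ K.∙-congʳ (K-comm (N j t) (h K.∙ g K.⁻¹)) ⟩
        ((h K.∙ g K.⁻¹) K.∙ N j t) K.∙ N j t K.⁻¹
          ≈⟨ //-rightDividesʳ (N j t) (h K.∙ g K.⁻¹) ⟩
        h K.∙ g K.⁻¹
          ≈⟨ φ∘φ⁻¹ (h K.∙ g K.⁻¹) ⟨
        φ (φ⁻¹ (h K.∙ g K.⁻¹)) ∎)
    i≡j : i ≡ j
    i≡j with Fin.<-cmp i j
    ... | tri< i<j _ _ = contradiction eq (unequal i<j)
    ... | tri≈ _ i≡j _ = i≡j
    ... | tri> _ _ j<i = contradiction (λ t → K.sym (eq t)) (unequal j<i)
    g≈h : ∀ {i j g h} → i ≡ j → (∀ t → N i t K.∙ g K.≈ N j t K.∙ h) → g K.≈ h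
    g≈h {i} ≡.refl eq = ∙-cancelˡ (N i Fin.zero) _ _ (eq Fin.zero)

  -- x = H i + α with g = φ(α).
  Represents : Word v → Fin v → K.Carrier → Set κ
  Represents x i g = ∀ t → φ (x t) K.≈ N i t K.∙ g

  C⇒Represents : ∀ {x} → x ∈ C[ H ] → ∃[ i ] ∃[ g ] Represents x i g
  C⇒Represents (i , α , eq) = i , φ α , λ t → K.trans (φ-cong (eq t)) (φ-+ (H i t) α)

  codeword : Fin v → K.Carrier → Word v
  codeword i g = H i ⊕ constant (φ⁻¹ g)

  codeword-represents : ∀ i g → Represents (codeword i g) i g
  codeword-represents i g t = K.trans (φ-+ (H i t) (φ⁻¹ g)) (K.∙-congˡ (φ∘φ⁻¹ g))

  codeword∈C : ∀ i g → codeword i g ∈ C[ H ]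
  codeword∈C i g = i , φ⁻¹ g , λ _ → F.refl

  Represents-≋ : ∀ {x y i j g h} → Represents x i g → Represents y j h →
                 i ≡ j → g K.≈ h → x ≋ y
  Represents-≋ x-rep y-rep ≡.refl g≈h t =
    φ-injective (K.trans (x-rep t) (K.trans (K.∙-congˡ g≈h) (K.sym (y-rep t))))

  Represents-unique : ∀ {x y i j g h} → Represents x i g → Represents y j h →
                      x ≋ y → i ≡ j × g K.≈ h
  Represents-unique x-rep y-rep x≋y = rows-unique λ t →
    K.trans (K.sym (x-rep t)) (K.trans (φ-cong (x≋y t)) (y-rep t))

  Represents⇒C : ∀ {x i g} → Represents x i g → x ∈ C[ H ]
  Represents⇒C {x} {i} {g} x-rep =
    i , φ⁻¹ g , Represents-≋ x-rep (codeword-represents i g) ≡.refl K.refl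

  row-represents : ∀ i → Represents (H i) i K.ε
  row-represents i t = K.sym (K.identityʳ (N i t))

  constant-represents : ∀ {x} α → x ≋ constant α → Represents x Fin.zero (φ α)
  constant-represents α eq t = K.trans (φ-cong (eq t))
    (K.sym (K.trans (K.∙-congʳ (N-row₀ t)) (K.identityˡ (φ α))))

  -- The equation expresses row `σ P i` scaled by `e P i` through `Q`, in every column since `σ Q`
  -- is onto; `rows-unique` then recovers index and scalar.
  Preserves-determined : ∀ {P Q P′ Q′} → Preserves (P , Q) → Preserves (P′ , Q′) →
    (∀ j → σ Q j ≡ σ Q′ j × e Q j K.≈ e Q′ j) → (P , Q) M.≈ᴾ (P′ , Q′)
  Preserves-determined {P} {Q} {P′} {Q′} A-pres B-pres Q≈Q′ =
    (λ i → rows-unique λ t → ≡.subst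
      (λ t → N (σ P i) t K.∙ e P i K.≈ N (σ P′ i) t K.∙ e P′ i)
      (Inverse.strictlyInverseˡ (perm Q) t) (eq i (σ⁻ Q t))) ,
    Q≈Q′
    where
    eq : ∀ i t → N (σ P i) (σ Q t) K.∙ e P i K.≈ N (σ P′ i) (σ Q t) K.∙ e P′ i
    eq i t = begin
      N (σ P i) (σ Q t) K.∙ e P i       ≈⟨ K-comm _ _ ⟩
      e P i K.∙ N (σ P i) (σ Q t)       ≈⟨ A-pres i t ⟩
      N i t K.∙ e Q t                   ≈⟨ K.∙-congˡ (proj₂ (Q≈Q′ t)) ⟩
      N i t K.∙ e Q′ t                  ≈⟨ B-pres i t ⟨
      e P′ i K.∙ N (σ P′ i) (σ Q′ t)    ≈⟨ K.∙-congˡ (N-cong ≡.refl (≡.sym (proj₁ (Q≈Q′ t)))) ⟩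
      e P′ i K.∙ N (σ P′ i) (σ Q t)     ≈⟨ K-comm _ _ ⟩
      N (σ P′ i) (σ Q t) K.∙ e P′ i     ∎

  ∙-fixedʳ : ∀ {g h} → g K.∙ h K.≈ g → h K.≈ K.ε
  ∙-fixedʳ = identityʳ-unique _ _

  Θ-trivial : ∀ {A} → A M.≈ᴾ M.εᴾ → Θ A E.≈ᴾ E.εᴾ
  Θ-trivial {A} A≈ε = Group.trans E.pairGroup {Θ A} {Θ M.εᴾ} {E.εᴾ} (Θ-cong {A} {M.εᴾ} A≈ε) Θ-ε

  -- From a full propelinear structure to a regular subgroup.

  module FullPropelinear⇒Regular (propelinear : FullPropelinear C[ H ]) where
    open FullPropelinear propelinear

    row : Fin v → ∃ C[ H ]
    row i = H i , Represents⇒C (row-represents i)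

    -- The automorphism induced by y ↦ x ⋆ y on the codewords has this Q, and Q forces P.
    Realizes : M.Monomial → ∃ C[ H ] → Set κ
    Realizes Q x = ∀ j → σ Q j ≡ π x ⟨$⟩ʳ j × e Q j K.≈ φ (proj₁ x (π x ⟨$⟩ʳ j))

    R : Pred M.MonomialPair (c ⊔ ℓ ⊔ k ⊔ κ)
    R (P , Q) = (P , Q) ∈ M.Aut N × ∃[ x ] Realizes Q x

    R-preserves : ∀ {A} → A ∈ R → Preserves A
    R-preserves {A} (A∈Aut , _) = Aut⇒Preserves N N-cong {A} A∈Aut

    0ᶜ : ∃ C[ H ]
    0ᶜ = constant F.0# , 0∈C

    π-0 : ∀ x → proj₁ x ≋ constant F.0# → ∀ j → π x ⟨$⟩ʳ j ≡ j
    π-0 x x≋0 = π-constant x (F.0# , x≋0)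

    R-resp : ∀ {A B} → A M.≈ᴾ B → A ∈ R → B ∈ R
    R-resp {A} {B} A≈B A∈R@(_ , x , A-real) =
      Preserves⇒Aut N N-cong {B}
        (Preserves-resp N N-cong {A} {B} A≈B (R-preserves {A} A∈R)) ,
      x , λ j → ≡.trans (≡.sym (proj₁ (proj₂ A≈B j))) (proj₁ (A-real j)) ,
                K.trans (K.sym (proj₂ (proj₂ A≈B j))) (proj₂ (A-real j))

    R-ε : M.εᴾ ∈ R
    R-ε = Preserves⇒Aut N N-cong {M.εᴾ} (Preserves-ε N N-cong) ,
          0ᶜ , λ j → ≡.sym (π-0 0ᶜ (λ _ → F.refl) j) , K.sym φ-0

    R-∙ : ∀ {A B} → A ∈ R → B ∈ R → (A 𝒢.∙ B) ∈ R
    R-∙ {A@(_ , Q)} {B@(_ , Q′)} A∈R@(_ , x , A-real) B∈R@(_ , y , B-real) =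
      Preserves⇒Aut N N-cong {A 𝒢.∙ B}
        (Preserves-∙ N N-cong {A} {B} (R-preserves {A} A∈R) (R-preserves {B} B∈R)) ,
      yx , λ j → σ-eq j , K.trans (e-eq j)
        (φ-cong (F.reflexive (≡.cong (proj₁ yx) (≡.sym (π-homo y x yx (λ _ → F.refl) j)))))
      where
      -- The codewords multiply in reverse: `A ∙ B` permutes columns by `Q` first, and `π` of
      -- `y ⋆ x` applies `π x` first.
      yx : ∃ C[ H ]
      yx = y ⋆ proj₁ x , ⋆-closed y (proj₂ x)
      σ-eq′ : ∀ j → σ Q′ (σ Q j) ≡ π y ⟨$⟩ʳ (π x ⟨$⟩ʳ j)
      σ-eq′ j = ≡.trans (proj₁ (B-real (σ Q j))) (≡.cong (π y ⟨$⟩ʳ_) (proj₁ (A-real j)))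
      σ-eq : ∀ j → σ Q′ (σ Q j) ≡ π yx ⟨$⟩ʳ j
      σ-eq j = ≡.trans (σ-eq′ j) (≡.sym (π-homo y x yx (λ _ → F.refl) j))
      e-eq : ∀ j → e Q j K.∙ e Q′ (σ Q j) K.≈ φ (proj₁ yx (π y ⟨$⟩ʳ (π x ⟨$⟩ʳ j)))
      e-eq j = begin
        e Q j K.∙ e Q′ (σ Q j)
          ≈⟨ K.∙-cong (proj₂ (A-real j)) (proj₂ (B-real (σ Q j))) ⟩
        φ (proj₁ x (π x ⟨$⟩ʳ j)) K.∙ φ (proj₁ y (π y ⟨$⟩ʳ σ Q j))
          ≈⟨ K-comm _ _ ⟩
        φ (proj₁ y (π y ⟨$⟩ʳ σ Q j)) K.∙ φ (proj₁ x (π x ⟨$⟩ʳ j))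
          ≈⟨ φ-+ _ _ ⟨
        φ (proj₁ y (π y ⟨$⟩ʳ σ Q j) F.+ proj₁ x (π x ⟨$⟩ʳ j))
          ≈⟨ φ-cong (F.+-cong
               (F.reflexive (≡.cong (λ t → proj₁ y (π y ⟨$⟩ʳ t)) (proj₁ (A-real j))))
               (F.reflexive (≡.cong (proj₁ x) (≡.sym (Inverse.strictlyInverseʳ (π y) _))))) ⟩
        φ (proj₁ yx (π y ⟨$⟩ʳ (π x ⟨$⟩ʳ j))) ∎

    R-⁻¹ : ∀ {A} → A ∈ R → (A 𝒢.⁻¹) ∈ R
    R-⁻¹ {A@(_ , Q)} A∈R@(_ , x , A-real) =
      Preserves⇒Aut N N-cong {A 𝒢.⁻¹} (Preserves-⁻¹ N N-cong {A} (R-preserves {A} A∈R)) ,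
      y , λ j → σ⁻-eq j , e⁻-eq j
      where
      -- The inverse of `x` under `⋆` is the word that `x` carries to zero.
      onto : ∃[ y ] (y ∈ C[ H ] × constant F.0# ≋ x ⋆ y)
      onto = ⋆-onto x 0∈C
      y : ∃ C[ H ]
      y = proj₁ onto , proj₁ (proj₂ onto)
      0≋x⋆y : constant F.0# ≋ x ⋆ proj₁ y
      0≋x⋆y = proj₂ (proj₂ onto)
      πxπy : ∀ j → π x ⟨$⟩ʳ (π y ⟨$⟩ʳ j) ≡ j
      πxπy j = ≡.trans (≡.sym (π-homo x y 0ᶜ 0≋x⋆y j)) (π-0 0ᶜ (λ _ → F.refl) j)
      σ⁻-eq : ∀ j → σ⁻ Q j ≡ π y ⟨$⟩ʳ j
      σ⁻-eq j = ≡.trans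
        (≡.cong (σ⁻ Q) (≡.sym (≡.trans (proj₁ (A-real (π y ⟨$⟩ʳ j))) (πxπy j))))
        (Inverse.strictlyInverseʳ (perm Q) (π y ⟨$⟩ʳ j))
      e⁻-eq : ∀ j → e Q (σ⁻ Q j) K.⁻¹ K.≈ φ (proj₁ y (π y ⟨$⟩ʳ j))
      e⁻-eq j = K.sym (inverseʳ-unique _ _ (begin
        e Q (σ⁻ Q j) K.∙ φ (proj₁ y (π y ⟨$⟩ʳ j))
          ≈⟨ K.∙-congʳ (proj₂ (A-real (σ⁻ Q j))) ⟩
        φ (proj₁ x (π x ⟨$⟩ʳ σ⁻ Q j)) K.∙ φ (proj₁ y (π y ⟨$⟩ʳ j))
          ≈⟨ K.∙-congʳ (φ-cong (F.reflexive (≡.cong (proj₁ x) πxσ⁻))) ⟩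
        φ (proj₁ x j) K.∙ φ (proj₁ y (π y ⟨$⟩ʳ j))
          ≈⟨ K.∙-congˡ (φ-cong (F.reflexive (≡.cong (proj₁ y) π⁻≡))) ⟨
        φ (proj₁ x j) K.∙ φ (proj₁ y (π x ⟨$⟩ˡ j))
          ≈⟨ φ-+ _ _ ⟨
        φ ((x ⋆ proj₁ y) j)
          ≈⟨ φ-cong (0≋x⋆y j) ⟨
        φ F.0#
          ≈⟨ φ-0 ⟩
        K.ε ∎))
        where
        πxσ⁻ : π x ⟨$⟩ʳ σ⁻ Q j ≡ j
        πxσ⁻ = ≡.trans (≡.cong (π x ⟨$⟩ʳ_) (σ⁻-eq j)) (πxπy j)
        π⁻≡ : π x ⟨$⟩ˡ j ≡ π y ⟨$⟩ʳ j
        π⁻≡ = ≡.trans (≡.cong (π x ⟨$⟩ˡ_) (≡.sym (πxπy j)))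
                      (Inverse.strictlyInverseʳ (π x) (π y ⟨$⟩ʳ j))

    R-isSubgroup : IsSubgroup M.pairGroup R
    R-isSubgroup = record
      { resp      = λ {A} {B} → R-resp {A} {B}
      ; ε-closed  = R-ε
      ; ∙-closed  = λ {A} {B} → R-∙ {A} {B}
      ; ⁻¹-closed = λ {A} → R-⁻¹ {A}
      }

    -- Scalars satisfy the equation by commutativity of `K`, and the constant word `φ⁻¹ g` realizes
    -- them because its permutation is the identity.
    Z⊆R : M.Z ⊆ R
    Z⊆R {A} (g , A≈g) = R-resp {M.scalar g , M.scalar g} {A}
      (𝒢.sym {A} {M.scalar g , M.scalar g} A≈g)
      ( Preserves⇒Aut N N-cong {M.scalar g , M.scalar g} (λ i j → K-comm g (N i j))
      , x , λ j → ≡.sym (π-constant x (φ⁻¹ g , λ _ → F.refl) j) , K.sym (φ∘φ⁻¹ g))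
      where
      x : ∃ C[ H ]
      x = constant (φ⁻¹ g) ,
          Represents⇒C (constant-represents (φ⁻¹ g) (λ _ → F.refl))

    -- Each `x ⋆ H j` is again a codeword, so it is a translate of some row; the index of that row
    -- and the constant give the permutation and the entries of `P`.
    realize : ∀ x → ∃[ P ] ∃[ Q ] ((P , Q) ∈ M.Aut N × Realizes Q x)
    realize x = P , Q , Preserves⇒Aut N N-cong {P , Q} preserves , λ _ → ≡.refl , K.refl
      where
      image : ∀ j → ∃[ i ] ∃[ g ] Represents (x ⋆ H j) i g
      image j = C⇒Represents (⋆-closed x (proj₂ (row j)))
      s : Fin v → Fin v
      s j = proj₁ (image j)
      a′ : Fin v → K.Carrier
      a′ j = proj₁ (proj₂ (image j))
      b′ : Fin v → K.Carrier
      b′ t = φ (proj₁ x (π x ⟨$⟩ʳ t))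
      φ-⋆ : ∀ y t → φ ((x ⋆ y) (π x ⟨$⟩ʳ t)) K.≈ φ (y t) K.∙ b′ t
      φ-⋆ y t = begin
        φ (proj₁ x (π x ⟨$⟩ʳ t) F.+ y (π x ⟨$⟩ˡ (π x ⟨$⟩ʳ t)))
          ≈⟨ φ-+ _ _ ⟩
        b′ t K.∙ φ (y (π x ⟨$⟩ˡ (π x ⟨$⟩ʳ t)))
          ≈⟨ K-comm _ _ ⟩
        φ (y (π x ⟨$⟩ˡ (π x ⟨$⟩ʳ t))) K.∙ b′ t
          ≈⟨ K.∙-congʳ (φ-cong (F.reflexive (≡.cong y (Inverse.strictlyInverseʳ (π x) t)))) ⟩
        φ (y t) K.∙ b′ t ∎
      preserves : ∀ j t → a′ j K.∙ N (s j) (π x ⟨$⟩ʳ t) K.≈ N j t K.∙ b′ t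
      preserves j t = begin
        a′ j K.∙ N (s j) (π x ⟨$⟩ʳ t)      ≈⟨ K-comm _ _ ⟩
        N (s j) (π x ⟨$⟩ʳ t) K.∙ a′ j      ≈⟨ proj₂ (proj₂ (image j)) (π x ⟨$⟩ʳ t) ⟨
        φ ((x ⋆ H j) (π x ⟨$⟩ʳ t))         ≈⟨ φ-⋆ (H j) t ⟩
        N j t K.∙ b′ t                     ∎
      -- If the images of rows `i` and `j` are translates of one row, cancelling `b′` makes rows `i`
      -- and `j` translates of each other.
      s-injective : ∀ {i j} → s i ≡ s j → i ≡ j
      s-injective {i} {j} si≡sj = proj₁ (rows-unique {i} {j} {a′ j} {a′ i} λ t →
        ∙-cancelʳ (b′ t) _ _ (begin
          (N i t K.∙ a′ j) K.∙ b′ t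
            ≈⟨ xy∙z≈xz∙y (N i t) (a′ j) (b′ t) ⟩
          (N i t K.∙ b′ t) K.∙ a′ j
            ≈⟨ K.∙-congʳ (preserves i t) ⟨
          (a′ i K.∙ N (s i) (π x ⟨$⟩ʳ t)) K.∙ a′ j
            ≈⟨ xy∙z≈zy∙x (a′ i) _ (a′ j) ⟩
          (a′ j K.∙ N (s i) (π x ⟨$⟩ʳ t)) K.∙ a′ i
            ≈⟨ K.∙-congʳ (K.∙-congˡ (N-cong si≡sj ≡.refl)) ⟩
          (a′ j K.∙ N (s j) (π x ⟨$⟩ʳ t)) K.∙ a′ i
            ≈⟨ K.∙-congʳ (preserves j t) ⟩
          (N j t K.∙ b′ t) K.∙ a′ i
            ≈⟨ xy∙z≈xz∙y (N j t) (b′ t) (a′ i) ⟩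
          (N j t K.∙ a′ i) K.∙ b′ t ∎))
      s-surjective : ∀ i → ∃[ j ] s j ≡ i
      s-surjective = injective⇒surjective s-injective
      P Q : M.Monomial
      P = record
        { perm  = record
          { to = s ; from = λ i → proj₁ (s-surjective i)
          ; to-cong = ≡.cong s ; from-cong = ≡.cong (λ i → proj₁ (s-surjective i))
          ; inverse = (λ { {i} ≡.refl → proj₂ (s-surjective i) })
                    , (λ { ≡.refl → s-injective (proj₂ (s-surjective _)) })
          }
        ; entry = record { to = a′ ; cong = λ { ≡.refl → K.refl } }
        }
      Q = record
        { perm  = π x
        ; entry = record { to = b′ ; cong = λ { ≡.refl → K.refl } }
        }

    -- Row 0 of `N` is trivial, so the equation there has only the entry of `Q`, a value of `x`, on
    -- its right.
    Realizes⇒Represents : ∀ {P Q x} → Preserves (P , Q) → Realizes Q x →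
                          Represents (proj₁ x) (σ P Fin.zero) (e P Fin.zero)
    Realizes⇒Represents {P} {Q} {x} A-pres A-real t = ≡.subst
      (λ t → φ (proj₁ x t) K.≈ N (σ P Fin.zero) t K.∙ e P Fin.zero)
      (Inverse.strictlyInverseˡ (perm Q) t) (eq (σ⁻ Q t))
      where
      eq : ∀ t → φ (proj₁ x (σ Q t)) K.≈ N (σ P Fin.zero) (σ Q t) K.∙ e P Fin.zero
      eq t = begin
        φ (proj₁ x (σ Q t))
          ≈⟨ φ-cong (F.reflexive (≡.cong (proj₁ x) (proj₁ (A-real t)))) ⟩
        φ (proj₁ x (π x ⟨$⟩ʳ t))                     ≈⟨ proj₂ (A-real t) ⟨
        e Q t                                        ≈⟨ K.identityˡ _ ⟨
        K.ε K.∙ e Q t                                ≈⟨ K.∙-congʳ (N-row₀ t) ⟨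
        N Fin.zero t K.∙ e Q t                       ≈⟨ A-pres Fin.zero t ⟨
        e P Fin.zero K.∙ N (σ P Fin.zero) (σ Q t)    ≈⟨ K-comm _ _ ⟩
        N (σ P Fin.zero) (σ Q t) K.∙ e P Fin.zero    ∎

    -- `π-free` only refutes non-constancy; a positive answer comes from deciding whether all
    -- coordinates equal the one at `j`.
    π-fixed⇒constant : ∀ x j → π x ⟨$⟩ʳ j ≡ j → IsConstant (proj₁ x)
    π-fixed⇒constant x j πj≡j with Fin.all? (λ t → proj₁ x t F.≟ proj₁ x j)
    ... | yes const = proj₁ x j , const
    ... | no ¬const = contradiction πj≡j
      (π-free x (λ { (α , eq) → ¬const (λ t → F.trans (eq t) (F.sym (eq j))) }) j)

    constant-trivial : ∀ {A} (A∈R : A ∈ R) → let x = proj₁ (proj₂ A∈R) in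
                       (∃[ α ] (proj₁ x ≋ constant α × φ α K.≈ K.ε)) → A M.≈ᴾ M.εᴾ
    constant-trivial {P , Q} A∈R@(_ , x , A-real) (α , x≋α , φα≈ε) =
      Preserves-determined {P} {Q} {proj₁ M.εᴾ} {proj₂ M.εᴾ}
        (R-preserves {P , Q} A∈R) (Preserves-ε N N-cong) λ j →
          ≡.trans (proj₁ (A-real j)) (π-constant x (α , x≋α) j) ,
          K.trans (proj₂ (A-real j)) (K.trans (φ-cong (x≋α _)) φα≈ε)

    -- The hypotheses give `H i ≋ x ⋆ H i`, so `π x` fixes every value of `π (row i)` and `x` is
    -- constant. Column 0 of row `i` then forces the constant to be trivial.
    row-free : ∀ {A} → A ∈ R → ∀ i → σ (proj₁ A) i ≡ i → e (proj₁ A) i K.≈ K.ε →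
               A M.≈ᴾ M.εᴾ
    row-free {A@(P , Q)} A∈R@(_ , x , A-real) i σi≡i ei≈ε =
      constant-trivial {A} A∈R (α , x≋α , φα≈ε)
      where
      eq : ∀ t → N i (σ Q t) K.≈ N i t K.∙ e Q t
      eq t = begin
        N i (σ Q t)                      ≈⟨ N-cong σi≡i ≡.refl ⟨
        N (σ P i) (σ Q t)                ≈⟨ K.identityˡ _ ⟨
        K.ε K.∙ N (σ P i) (σ Q t)        ≈⟨ K.∙-congʳ ei≈ε ⟨
        e P i K.∙ N (σ P i) (σ Q t)      ≈⟨ R-preserves {A} A∈R i t ⟩
        N i t K.∙ e Q t                  ∎
      w≋x⋆w : H i ≋ x ⋆ H i
      w≋x⋆w t = φ-injective (begin
        N i t
          ≈⟨ N-cong ≡.refl (≡.trans (proj₁ (A-real t′)) (Inverse.strictlyInverseˡ (π x) t)) ⟨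
        N i (σ Q t′)
          ≈⟨ eq t′ ⟩
        N i t′ K.∙ e Q t′
          ≈⟨ K-comm _ _ ⟩
        e Q t′ K.∙ N i t′
          ≈⟨ K.∙-congʳ (proj₂ (A-real t′)) ⟩
        φ (proj₁ x (π x ⟨$⟩ʳ t′)) K.∙ N i t′
          ≈⟨ K.∙-congʳ (φ-cong (F.reflexive (≡.cong (proj₁ x) (Inverse.strictlyInverseˡ (π x) t)))) ⟩
        φ (proj₁ x t) K.∙ N i t′
          ≈⟨ φ-+ _ _ ⟨
        φ ((x ⋆ H i) t) ∎)
        where t′ = π x ⟨$⟩ˡ t
      x-constant : IsConstant (proj₁ x)
      x-constant = π-fixed⇒constant x (π (row i) ⟨$⟩ʳ Fin.zero)
        (≡.sym (π-homo x (row i) (row i) w≋x⋆w Fin.zero))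
      α = proj₁ x-constant
      x≋α = proj₂ x-constant
      φα≈ε : φ α K.≈ K.ε
      φα≈ε = ∙-fixedʳ (begin
        N i Fin.zero K.∙ φ α             ≈⟨ K.∙-congˡ (φ-cong (x≋α _)) ⟨
        N i Fin.zero K.∙ φ (proj₁ x _)   ≈⟨ K.∙-congˡ (proj₂ (A-real Fin.zero)) ⟨
        N i Fin.zero K.∙ e Q Fin.zero    ≈⟨ eq Fin.zero ⟨
        N i (σ Q Fin.zero)
          ≈⟨ N-cong ≡.refl (≡.trans (proj₁ (A-real Fin.zero)) (π-constant x x-constant Fin.zero)) ⟩
        N i Fin.zero                     ∎)

    column-free : ∀ {A} → A ∈ R → ∀ j → σ (proj₂ A) j ≡ j → e (proj₂ A) j K.≈ K.ε →
                  A M.≈ᴾ M.εᴾ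
    column-free {A} A∈R@(_ , x , A-real) j σj≡j ej≈ε =
      constant-trivial {A} A∈R (proj₁ x-constant , proj₂ x-constant ,
        K.trans (K.sym (K.trans (proj₂ (A-real j)) (φ-cong (proj₂ x-constant _)))) ej≈ε)
      where
      x-constant : IsConstant (proj₁ x)
      x-constant = π-fixed⇒constant x j (≡.trans (≡.sym (proj₁ (A-real j))) σj≡j)

    element : FiniteSetoid.Carrier (Kᶠ ×ᴷ I) → M.MonomialPair
    element (g , i) = let P , Q , _ = realize (codeword i g , codeword∈C i g) in P , Q

    element∈R : ∀ u → element u ∈ R
    element∈R (g , i) = let _ , _ , A∈Aut , A-real = realize (codeword i g , codeword∈C i g)
                        in A∈Aut , (codeword i g , codeword∈C i g) , A-real

    -- Recovers the index from the image of row 0, which makes the family `element` injective, as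
    -- `free⇒regular` requires.
    element-row₀ : ∀ g i → i ≡ σ (proj₁ (element (g , i))) Fin.zero ×
                           g K.≈ e (proj₁ (element (g , i))) Fin.zero
    element-row₀ g i = Represents-unique (codeword-represents i g)
      (Realizes⇒Represents {P} {Q} {x} (R-preserves {P , Q} A∈R) (proj₂ (proj₂ A∈R)))
      (λ _ → F.refl)
      where
      x : ∃ C[ H ]
      x = codeword i g , codeword∈C i g
      P = proj₁ (element (g , i))
      Q = proj₂ (element (g , i))
      A∈R = element∈R (g , i)

    Θ[R]-isRegular : E.IsRegular Θ[ R ]
    Θ[R]-isRegular =
      regular rowAction-isAction′ (λ { B (A , A∈R , B≈) (g , i) fixed →
        let g≈ , i≡ = ≈-trans (≈-sym (proj₁ (proj₁ B≈ (g , i)))) fixed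
        in ≈ε {B} {A} B≈ (row-free {A} A∈R i i≡ (∙-fixedʳ g≈)) }) ,
      regular columnAction-isAction′ (λ { B (A , A∈R , B≈) (g , j) fixed →
        let g≈ , j≡ = ≈-trans (≈-sym (proj₁ (proj₂ B≈ (g , j)))) fixed
        in ≈ε {B} {A} B≈ (column-free {A} A∈R j j≡
             -- On columns `Θ` multiplies by the inverse entry, so it is the inverse that is seen to
             -- be trivial.
             (⁻¹-injective (K.trans (∙-fixedʳ g≈) (K.sym ε⁻¹≈ε)))) })
      where
      open FiniteSetoid (Kᶠ ×ᴷ I) using (_≈_) renaming (trans to ≈-trans; sym to ≈-sym)
      rowAction-isAction′ = rowAction-isAction Kᶠ (Kᶠ ×ᴷ I)
      columnAction-isAction′ = columnAction-isAction Kᶠ (Kᶠ ×ᴷ I)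
      ≈ε : ∀ {B A} → B E.≈ᴾ Θ A → A M.≈ᴾ M.εᴾ → B E.≈ᴾ E.εᴾ
      ≈ε {B} {A} B≈ A≈ε = Group.trans E.pairGroup {B} {Θ A} {E.εᴾ} B≈ (Θ-trivial {A} A≈ε)
      element-injective : ∀ {u w} → Θ (element u) E.≈ᴾ Θ (element w) → u ≈ w
      element-injective {g , i} {h , j} eq =
        let P≈ , _ = Θ-injective {element (g , i)} {element (h , j)} eq
            i≡ , g≈ = element-row₀ g i
            j≡ , h≈ = element-row₀ h j
        in K.trans g≈ (K.trans (proj₂ (P≈ Fin.zero)) (K.sym h≈)) ,
           ≡.trans i≡ (≡.trans (proj₁ (P≈ Fin.zero)) (≡.sym j≡))
      regular : ∀ {act} → IsAction Kᶠ (Kᶠ ×ᴷ I) act →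
                (∀ B → B ∈ Θ[ R ] → ∀ u → act B u ≈ u → B E.≈ᴾ E.εᴾ) →
                E.RegularAction Θ[ R ] act
      regular isAction = free⇒regular Kᶠ (Kᶠ ×ᴷ I) (Θ-isSubgroup R-isSubgroup) isAction
        (Θ ∘ element)
        (λ u → element u , element∈R u , Group.refl E.pairGroup {Θ (element u)})
        (λ {u} {w} → element-injective {u} {w})

  -- From a regular subgroup to a full propelinear structure.

  module Regular⇒FullPropelinear {R : Pred M.MonomialPair r}
    (R-isSubgroup : IsSubgroup M.pairGroup R) (R⊆Aut : R ⊆ M.Aut N) (Z⊆R : M.Z ⊆ R)
    (Θ[R]-isRegular : E.IsRegular Θ[ R ]) where
    open IsSubgroup R-isSubgroup

    R-preserves : ∀ {A} → A ∈ R → Preserves A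
    R-preserves {A} A∈R = Aut⇒Preserves N N-cong {A} (R⊆Aut A∈R)

    ∈Θ[R] : ∀ {A} → A ∈ R → Θ A ∈ Θ[ R ]
    ∈Θ[R] {A} A∈R = A , A∈R , Group.refl E.pairGroup {Θ A}

    Θ≈ε⇒≈ε : ∀ {A} → Θ A E.≈ᴾ E.εᴾ → A M.≈ᴾ M.εᴾ
    Θ≈ε⇒≈ε {A} eq = Θ-injective {A} {M.εᴾ}
      (Group.trans E.pairGroup {Θ A} {E.εᴾ} {Θ M.εᴾ} eq
        (Group.sym E.pairGroup {Θ M.εᴾ} {E.εᴾ} Θ-ε))

    -- Under `Θ A` the row `(ε , i)` of `ℰ` is then fixed, so regularity on rows applies.
    row-free : ∀ {A} → A ∈ R → ∀ i → σ (proj₁ A) i ≡ i → e (proj₁ A) i K.≈ K.ε →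
               A M.≈ᴾ M.εᴾ
    row-free {A} A∈R i σi≡i ei≈ε = Θ≈ε⇒≈ε {A}
      (proj₂ (proj₁ Θ[R]-isRegular) (Θ A) (∈Θ[R] {A} A∈R) (K.ε , i)
        (K.trans (K.identityˡ _) ei≈ε , σi≡i))

    column-free : ∀ {A} → A ∈ R → ∀ j → σ (proj₂ A) j ≡ j → e (proj₂ A) j K.≈ K.ε →
                  A M.≈ᴾ M.εᴾ
    column-free {A} A∈R j σj≡j ej≈ε = Θ≈ε⇒≈ε {A}
      (proj₂ (proj₂ Θ[R]-isRegular) (Θ A) (∈Θ[R] {A} A∈R) (K.ε , j)
        (K.trans (K.identityˡ _) (K.trans (K.⁻¹-cong ej≈ε) ε⁻¹≈ε) , σj≡j))

    -- The quotient `A ∙ B ⁻¹` fixes row 0 with trivial entry.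
    row₀-determines : ∀ {A B} → A ∈ R → B ∈ R →
      σ (proj₁ A) Fin.zero ≡ σ (proj₁ B) Fin.zero →
      e (proj₁ A) Fin.zero K.≈ e (proj₁ B) Fin.zero → A M.≈ᴾ B
    row₀-determines {A@(P , _)} {B@(P′ , _)} A∈R B∈R σ≡ e≈ =
      GroupProperties.x∙y⁻¹≈ε⇒x≈y M.pairGroup A B
        (row-free {A 𝒢.∙ B 𝒢.⁻¹} (∙-closed {A} {B 𝒢.⁻¹} A∈R (⁻¹-closed {B} B∈R)) Fin.zero σ⁻σ≡0
          (x≈y⇒x∙y⁻¹≈ε (K.trans e≈ (Func.cong (entry P′) (≡.sym σ⁻σ≡0)))))
      where
      σ⁻σ≡0 : σ⁻ P′ (σ P Fin.zero) ≡ Fin.zero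
      σ⁻σ≡0 = ≡.trans (≡.cong (σ⁻ P′) σ≡) (Inverse.strictlyInverseʳ (perm P′) Fin.zero)

    -- Transitivity moves row `(ε , 0)` of `ℰ` to the row `(g , i)` that encodes `x`. The choice
    -- goes through the membership proof; `row₀-determines` later shows that the result depends on
    -- the word alone.
    choose : ∀ x → x ∈ C[ H ] →
             ∃[ P ] ∃[ Q ] ((P , Q) ∈ R × Represents x (σ P Fin.zero) (e P Fin.zero))
    choose x x∈C
      with i , g , x-rep ← C⇒Represents x∈C
      with B , ((P , Q) , A∈R , B≈) , (g≈ , i≡) ←
             proj₁ (proj₁ Θ[R]-isRegular) (K.ε , Fin.zero) (g , i)
      = P , Q , A∈R , λ t → K.trans (x-rep t) (K.∙-cong
          (N-cong (≡.trans (≡.sym i≡) (proj₂ (proj₁ (proj₁ B≈ (K.ε , Fin.zero))))) ≡.refl)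
          (K.trans (K.sym g≈)
            (K.trans (proj₁ (proj₁ (proj₁ B≈ (K.ε , Fin.zero)))) (K.identityˡ _))))

    row⟨_⟩ column⟨_⟩ : ∃ C[ H ] → M.Monomial
    row⟨ x , x∈C ⟩    = proj₁ (choose x x∈C)
    column⟨ x , x∈C ⟩ = proj₁ (proj₂ (choose x x∈C))

    pair⟨_⟩ : ∃ C[ H ] → M.MonomialPair
    pair⟨ x ⟩ = row⟨ x ⟩ , column⟨ x ⟩

    pair∈R : ∀ x → pair⟨ x ⟩ ∈ R
    pair∈R (x , x∈C) = proj₁ (proj₂ (proj₂ (choose x x∈C)))

    pair-represents : ∀ x → Represents (proj₁ x) (σ row⟨ x ⟩ Fin.zero) (e row⟨ x ⟩ Fin.zero)
    pair-represents (x , x∈C) = proj₂ (proj₂ (proj₂ (choose x x∈C)))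

    π : ∃ C[ H ] → Permutation′ v
    π x = perm column⟨ x ⟩

    π-unique : ∀ x {A i g} → A ∈ R → Represents (proj₁ x) i g →
               i ≡ σ (proj₁ A) Fin.zero → g K.≈ e (proj₁ A) Fin.zero →
               pair⟨ x ⟩ M.≈ᴾ A
    π-unique x {A} A∈R x-rep i≡ g≈
      with σ≡ , e≈ ← Represents-unique (pair-represents x) x-rep (λ _ → F.refl) =
      row₀-determines {pair⟨ x ⟩} {A} (pair∈R x) A∈R (≡.trans σ≡ i≡) (K.trans e≈ g≈)

    -- Row 0 of the automorphism equation, where N is trivial.
    column-entry : ∀ x t → φ (proj₁ x (π x ⟨$⟩ʳ t)) K.≈ e column⟨ x ⟩ t
    column-entry x t = begin
      φ (proj₁ x (π x ⟨$⟩ʳ t))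
        ≈⟨ pair-represents x (π x ⟨$⟩ʳ t) ⟩
      N (σ row⟨ x ⟩ Fin.zero) (π x ⟨$⟩ʳ t) K.∙ e row⟨ x ⟩ Fin.zero
        ≈⟨ K-comm _ _ ⟩
      e row⟨ x ⟩ Fin.zero K.∙ N (σ row⟨ x ⟩ Fin.zero) (π x ⟨$⟩ʳ t)
        ≈⟨ R-preserves {pair⟨ x ⟩} (pair∈R x) Fin.zero t ⟩
      N Fin.zero t K.∙ e column⟨ x ⟩ t
        ≈⟨ K.∙-congʳ (N-row₀ t) ⟩
      K.ε K.∙ e column⟨ x ⟩ t
        ≈⟨ K.identityˡ _ ⟩
      e column⟨ x ⟩ t ∎

    infixr 7 _⋆_
    _⋆_ : ∃ C[ H ] → Word v → Word v
    x ⋆ y = proj₁ x ⊕ permute (π x) y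

    -- At `t = π x t′` the value of `x` is the entry of the column part at `t′`, so the automorphism
    -- equation in row `i` applies. Closure, surjectivity and the homomorphism law all rest on this
    -- formula.
    ⋆-represents : ∀ x {y i g} → Represents y i g →
                   Represents (x ⋆ y) (σ row⟨ x ⟩ i) (e row⟨ x ⟩ i K.∙ g)
    ⋆-represents x {y} {i} {g} y-rep t = begin
      φ (proj₁ x t F.+ y t′)
        ≈⟨ φ-+ _ _ ⟩
      φ (proj₁ x t) K.∙ φ (y t′)
        ≈⟨ K.∙-congʳ (φ-cong (F.reflexive (≡.cong (proj₁ x) πt′≡t))) ⟨
      φ (proj₁ x (π x ⟨$⟩ʳ t′)) K.∙ φ (y t′)
        ≈⟨ K.∙-cong (column-entry x t′) (y-rep t′) ⟩
      e column⟨ x ⟩ t′ K.∙ (N i t′ K.∙ g)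
        ≈⟨ x∙yz≈yx∙z _ _ _ ⟩
      (N i t′ K.∙ e column⟨ x ⟩ t′) K.∙ g
        ≈⟨ K.∙-congʳ (R-preserves {pair⟨ x ⟩} (pair∈R x) i t′) ⟨
      (e row⟨ x ⟩ i K.∙ N (σ row⟨ x ⟩ i) (π x ⟨$⟩ʳ t′)) K.∙ g
        ≈⟨ xy∙z≈y∙xz _ _ _ ⟩
      N (σ row⟨ x ⟩ i) (π x ⟨$⟩ʳ t′) K.∙ (e row⟨ x ⟩ i K.∙ g)
        ≈⟨ K.∙-congʳ (N-cong ≡.refl πt′≡t) ⟩
      N (σ row⟨ x ⟩ i) t K.∙ (e row⟨ x ⟩ i K.∙ g) ∎
      where
      t′ = π x ⟨$⟩ˡ t
      πt′≡t : π x ⟨$⟩ʳ t′ ≡ t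
      πt′≡t = Inverse.strictlyInverseˡ (π x) t

    ⋆-onto : ∀ x {z} → z ∈ C[ H ] → ∃[ y ] (y ∈ C[ H ] × z ≋ x ⋆ y)
    ⋆-onto x z∈C with i , g , z-rep ← C⇒Represents z∈C =
      codeword i′ g′ , codeword∈C i′ g′ ,
      Represents-≋ z-rep (⋆-represents x (codeword-represents i′ g′))
        (≡.sym (Inverse.strictlyInverseˡ (perm row⟨ x ⟩) i))
        (K.sym (\\-leftDividesˡ (e row⟨ x ⟩ i′) g))
      where
      -- `i′` and `g′` undo the row permutation and the scalar that `⋆-represents` introduces.
      i′ = σ⁻ row⟨ x ⟩ i
      g′ = e row⟨ x ⟩ i′ K.⁻¹ K.∙ g

    -- A fixed column forces `pair⟨ x ⟩` to be scalar, so its row part fixes 0 and `x` is a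
    -- translate of the zero row.
    π-free : ∀ x → ¬ IsConstant (proj₁ x) → ∀ i → π x ⟨$⟩ʳ i ≢ i
    π-free x ¬const i πi≡i = ¬const (φ⁻¹ g , λ t → φ-injective (begin
      φ (proj₁ x t)                                  ≈⟨ pair-represents x t ⟩
      N (σ row⟨ x ⟩ Fin.zero) t K.∙ g
        ≈⟨ K.∙-congʳ (N-cong (proj₁ (proj₁ trivial Fin.zero)) ≡.refl) ⟩
      N Fin.zero t K.∙ g                             ≈⟨ K.∙-congʳ (N-row₀ t) ⟩
      K.ε K.∙ g                                      ≈⟨ K.identityˡ g ⟩
      g                                              ≈⟨ φ∘φ⁻¹ g ⟨
      φ (φ⁻¹ g)                                      ∎))
      where
      g = e row⟨ x ⟩ Fin.zero
      h = e column⟨ x ⟩ i K.⁻¹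
      -- The scalar h cancels the entry of Q in row i, so the product fixes column (ε , i) of ℰ.
      trivial : (pair⟨ x ⟩ 𝒢.∙ (M.scalar h , M.scalar h)) M.≈ᴾ M.εᴾ
      trivial = column-free {pair⟨ x ⟩ 𝒢.∙ (M.scalar h , M.scalar h)}
        (∙-closed {pair⟨ x ⟩} {M.scalar h , M.scalar h} (pair∈R x)
          (Z⊆R {M.scalar h , M.scalar h} (h , 𝒢.refl {M.scalar h , M.scalar h})))
        i πi≡i (K.inverseʳ _)

    fullPropelinear : FullPropelinear C[ H ]
    fullPropelinear = record
      { 0∈C        = Represents⇒C (constant-represents F.0# (λ _ → F.refl))
      ; π          = π
      ; π-cong     = λ x y x≋y i →
          let σ≡ , e≈ = Represents-unique (pair-represents x) (pair-represents y) x≋y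
          in proj₁ (proj₂ (row₀-determines {pair⟨ x ⟩} {pair⟨ y ⟩}
               (pair∈R x) (pair∈R y) σ≡ e≈) i)
      ; ⋆-closed   = λ x y∈C → let _ , _ , y-rep = C⇒Represents y∈C
                               in Represents⇒C (⋆-represents x y-rep)
      ; ⋆-onto     = ⋆-onto
      -- Both `pair⟨ z ⟩` and `pair⟨ y ⟩ ∙ pair⟨ x ⟩` send row 0 to the row of `x ⋆ y`, up to the
      -- order of the scalars in `K`.
      ; π-homo     = λ x y z z≋ i →
          let σ≡ , e≈ = Represents-unique (pair-represents z)
                          (⋆-represents x (pair-represents y)) z≋
          in proj₁ (proj₂ (row₀-determines {pair⟨ z ⟩} {pair⟨ y ⟩ 𝒢.∙ pair⟨ x ⟩}
               (pair∈R z) (∙-closed {pair⟨ y ⟩} {pair⟨ x ⟩} (pair∈R y) (pair∈R x))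
               σ≡ (K.trans e≈ (K-comm _ _))) i)
      ; π-free     = π-free
      -- The scalar pair of `φ α` lies in `R` and has the image of row 0 that encodes `x`, so it is
      -- `pair⟨ x ⟩`.
      ; π-constant = λ { x (α , x≋α) i →
          proj₁ (proj₂ (π-unique x {M.scalar (φ α) , M.scalar (φ α)}
            (Z⊆R {M.scalar (φ α) , M.scalar (φ α)} (φ α , 𝒢.refl {M.scalar (φ α) , M.scalar (φ α)}))
            (constant-represents α x≋α) ≡.refl K.refl) i) }
      }

-- Combination of the two implications.

theorem3p3 :
  ∀ {c ℓ k κ : Level} {q : ℕ} → IsPrimePower q →
  (𝔽 : FiniteField c ℓ q) →
  (v : ℕ) .{{_ : NonZero v}} (q∣v : q ∣ v) →
  let open Codes 𝔽 in
  (H : SquareMatrix v) → IsGH q∣v H → IsNormalized H →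
  (K : Group k κ) (φ : FiniteField.Carrier 𝔽 → Group.Carrier K) →
  (φ-iso : IsAdditiveIsomorphism 𝔽 K φ) →
  let
    Kᶠ = imageGroup 𝔽 K φ φ-iso
    I  = finiteFin v
    module M = Matrices Kᶠ I
    module E = Matrices Kᶠ (Kᶠ ×ᴷ I)
    open Expansion Kᶠ I
    φH : M.KMatrix
    φH = λ i j → φ (H i j)
  in
  IsGHFP q∣v C[ H ] ⇔
  (∃[ R ] (IsSubgroup {r = c ⊔ ℓ ⊔ k ⊔ κ} M.pairGroup R × R ⊆ M.Aut φH × M.Z ⊆ R ×
    IsSubgroup E.pairGroup Θ[ R ] × Θ[ R ] ⊆ E.PAut (ℰ φH) × E.IsRegular Θ[ R ] ×
    Θ[ M.Z ] ⊆ Θ[ R ]))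
theorem3p3 _ 𝔽 ℕ.zero q∣v H isGH isNormalized K φ φ-iso =
  contradiction ≡.refl (ℕ.≢-nonZero⁻¹ ℕ.zero)
theorem3p3 _ 𝔽 (ℕ.suc n) q∣v H isGH isNormalized K φ φ-iso = mk⇔
  (λ { (_ , propelinear) →
    let open FullPropelinear⇒Regular propelinear
        R⊆Aut = λ {A} (A∈R : A ∈ R) → proj₁ A∈R
    in R , R-isSubgroup , (λ {A} → R⊆Aut {A}) , (λ {A} → Z⊆R {A}) ,
       Θ-isSubgroup R-isSubgroup ,
       (λ {B} → Θ-Aut⊆PAut N N-cong {R = R} (λ {A} → R⊆Aut {A}) {B}) ,
       Θ[R]-isRegular , λ { (A , A∈Z , B≈) → A , Z⊆R {A} A∈Z , B≈ } })
  (λ { (R , R≤ , R⊆Aut , Z⊆R , _ , _ , regular , _) →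
    (H , isGH , (λ x∈C → x∈C) , (λ x∈C → x∈C)) ,
    Regular⇒FullPropelinear.fullPropelinear R≤
      (λ {A} → R⊆Aut {A}) (λ {A} → Z⊆R {A}) regular })
  where
  open HadamardCode 𝔽 q∣v H isGH isNormalized K φ φ-iso
  open ExpansionProperties Kᶠ I K-comm
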